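{- There exists a randomized $\frac{56}{627}$-competitive ($\frac{56}{627}\approx 0.0893$) online algorithm for the cardinality model, and it can be implemented in polynomial time at the cost of an $\varepsilon$ loss in the competitive ratio: for every constant $\varepsilon>0$ there is a polynomial time randomized $(\frac{56}{627}-\varepsilon)$-competitive online algorithm for this model. Moreover, if the objective function is restricted to be monotone, then there exists a polynomial time deterministic $\frac14$-competitive online algorithm for this model.
   Context: The cardinality model: there is an unknown finite ground set $\mathcal N=\{u_1,\dots,u_n\}$, a non-negative submodular function $f:2^{\mathcal N}\to\mathbb R_{\ge0}$ (not necessarily monotone), and a parameter $0\le k\le n$ known to the algorithm. A set $S\subseteq\mathcal N$ is feasible if and only if $|S|\le k$. The elements are revealed one by one in the order $u_1,\dots,u_n$, chosen by an adversary. The algorithm does not know $n$ in advance. It maintains feasible solutions $S_0=\varnothing,S_1,\dots,S_n$, where immediately after $u_i$ is revealed it chooses $S_i$ to be any feasible subset of $S_{i-1}\cup\{u_i\}$ (previously accepted elements may be dropped, but dropped or rejected elements cannot return). The choice may depend only on the values of $f$ on subsets of $\{u_1,\dots,u_i\}$ (accessed through a value oracle), the past, and, for randomized algorithms, internal randomness. The algorithm is $\alpha$-competitive if $\mathbb E[f(S_n)]\ge\alpha\cdot\max\{f(S): S\subseteq\mathcal N,\ |S|\le k\}$ for every instance. $f$ is monotone if $A\subseteq B\subseteq \mathcal N$ implies $f(A)\le f(B)$. Polynomial time means that the number of elementary operations and value oracle queries is polynomial in the number of elements revealed (for fixed $\varepsilon$), where arithmetic operations/comparisons on numbers and random draws count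 as elementary operations. -}

module Defs where

open import Level using (_⊔_) renaming (suc to ℓsuc)
open import Algebra.Bundles using (CommutativeRing)
open import Algebra.Definitions.RawMonoid using () renaming (_×_ to multiple)
open import Data.Bool.Base using (Bool; true; false; not; _∧_; if_then_else_)
open import Data.Fin.Subset using (Subset; inside; outside; _⊆_; _∪_; _∩_; ∣_∣)
open import Data.List.Base using (List; []; _∷_; _++_)
open import Data.Nat.Base as ℕ using (ℕ; zero; suc; _≡ᵇ_; _≤ᵇ_)
open import Data.Product.Base using (_×_; ∃₂; ∃-syntax; proj₁)
open import Data.Unit.Polymorphic.Base using (⊤)
open import Data.Vec.Base using ([]; _∷_)
open import Function.Base using (_∘_)
open import Relation.Binary.Core using (Rel)
open import Relation.Binary.PropositionalEquality.Core using (_≡_)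
open import Relation.Binary.Structures using (IsDecTotalOrder)
open import Relation.Nullary using (¬_; yes; no; does)

-- The library has no real numbers, so everything below is relative to an
-- arbitrary Archimedean ordered field whose order is decidable.  Classically ℝ
-- is such a field; ℚ is one constructively.  Decidability is the assumption
-- that numbers can be compared.
record ArchimedeanOrderedField c ℓ₁ ℓ₂ : Set (ℓsuc (c ⊔ ℓ₁ ⊔ ℓ₂)) where
  infix  4 _≤_ _<_
  infixl 7 _÷_
  field
    commutativeRing : CommutativeRing c ℓ₁

  open CommutativeRing commutativeRing public

  field
    _≤_             : Rel Carrier ℓ₂
    isDecTotalOrder : IsDecTotalOrder _≈_ _≤_
    0≉1             : ¬ (0# ≈ 1#)
    inverse         : ∀ x → ¬ (x ≈ 0#) → ∃[ y ] x * y ≈ 1#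
    +-monoˡ-≤       : ∀ z {x y} → x ≤ y → x + z ≤ y + z
    *-nonNeg        : ∀ {x y} → 0# ≤ x → 0# ≤ y → 0# ≤ x * y

  fromℕ : ℕ → Carrier
  fromℕ n = multiple +-rawMonoid n 1#

  field
    archimedean : ∀ x → ∃[ n ] x ≤ fromℕ n

  open IsDecTotalOrder isDecTotalOrder public
    using (_≟_; _≤?_)

  _<_ : Rel Carrier (ℓ₁ ⊔ ℓ₂)
  x < y = x ≤ y × ¬ (x ≈ y)

  -- Division is totalised by x ÷ 0 = 0.
  _÷_ : Carrier → Carrier → Carrier
  x ÷ y with y ≟ 0#
  ... | yes _   = 0#
  ... | no y≉0 = x * proj₁ (inverse y y≉0)

-- Programs for a real RAM.  Its memory consists of integer arrays and number
-- arrays; arrays are named by literals of the program and indexed by computed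
-- naturals.  The syntax has no constants for individual field elements.
data Mode : Set where
  deterministic randomized : Mode

infixl 7 _⊗_ _⊛_ _⊘_
infixl 6 _⊕_ _⊖_ _⊞_ _⊟_
infix  4 _≤ⁱ_ _≤ⁿ_
infixr 3 _and_

data IntExp : Set where
  lit          : ℕ → IntExp
  capacity     : IntExp                  -- the parameter k
  revealed     : IntExp                  -- the number of elements revealed so far
  int          : ℕ → IntExp → IntExp     -- int a e is the entry e of integer array a
  _⊕_ _⊖_ _⊗_ : IntExp → IntExp → IntExp -- _⊖_ is truncated subtraction

data NumExp : Set where
  fromInt          : IntExp → NumExp
  num              : ℕ → IntExp → NumExp
  _⊞_ _⊟_ _⊛_ _⊘_ : NumExp → NumExp → NumExp

data Test : Set where
  _≤ⁱ_  : IntExp → IntExp → Test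
  _≤ⁿ_  : NumExp → NumExp → Test
  neg   : Test → Test
  _and_ : Test → Test → Test

data Command : Mode → Set

Program : Mode → Set
Program m = List (Command m)

data Command where
  -- setInt a e d and setNum x e r: array name, index, new value.
  setInt : ∀ {m} → ℕ → IntExp → IntExp → Command m
  setNum : ∀ {m} → ℕ → IntExp → NumExp → Command m
  -- query x e a stores in entry e of number array x the value of the objective
  -- on the set of revealed u_j such that entry j of integer array a is nonzero.
  query  : ∀ {m} → ℕ → IntExp → ℕ → Command m
  -- toss a e p stores in entry e of integer array a a bit that is 1 with
  -- probability p (clamped to [0,1]).
  toss   : ℕ → IntExp → NumExp → Command randomized
  branch : ∀ {m} → Test → Program m → Program m → Command m
  while  : ∀ {m} → Test → Program m → Command m

module Model {c ℓ₁ ℓ₂} (ℝ : ArchimedeanOrderedField c ℓ₁ ℓ₂) where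

  open ArchimedeanOrderedField ℝ

  -- Random A: an A-valued random variable, as a finite tree of biased coin
  -- tosses; `coin p` takes its first branch with probability p.
  data Random {a} (A : Set a) : Set (c ⊔ ℓ₂ ⊔ a) where
    return : A → Random A
    coin   : (p : Carrier) → 0# ≤ p → p ≤ 1# → Random A → Random A → Random A

  infixl 1 _>>=_

  _>>=_ : ∀ {a b} {A : Set a} {B : Set b} → Random A → (A → Random B) → Random B
  return x         >>= g = g x
  coin p 0≤p p≤1 s t >>= g = coin p 0≤p p≤1 (s >>= g) (t >>= g)

  𝔼 : ∀ {a} {A : Set a} → (A → Carrier) → Random A → Carrier
  𝔼 g (return x)       = g x
  𝔼 g (coin p _ _ s t) = p * 𝔼 g s + (1# - p) * 𝔼 g t

  Surely : ∀ {a p} {A : Set a} → (A → Set p) → Random A → Set p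
  Surely P (return x)       = P x
  Surely P (coin _ _ _ s t) = Surely P s × Surely P t

  -- The ground set {u_1,…,u_n} is Fin n with the most recently revealed element
  -- first: u_j has index n − j.  Hence `outside ∷ S` is S seen as a set of
  -- elements of the ground set extended by a new one, and `inside ∷ S` is S
  -- with that new element added.
  SetFunction : ℕ → Set c
  SetFunction n = Subset n → Carrier

  restrict : ∀ {n} → SetFunction (suc n) → SetFunction n
  restrict f S = f (outside ∷ S)

  NonNegative Submodular Monotone : ∀ {n} → SetFunction n → Set ℓ₂
  NonNegative f = ∀ S → 0# ≤ f S
  Submodular  f = ∀ S T → f (S ∪ T) + f (S ∩ T) ≤ f S + f T
  Monotone    f = ∀ {S T} → S ⊆ T → f S ≤ f T

  Feasible : ∀ {n} → ℕ → Subset n → Set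
  Feasible k S = ∣ S ∣ ℕ.≤ k

  IsOptimal : ∀ {n} → ℕ → SetFunction n → Subset n → Set ℓ₂
  IsOptimal k f S* = Feasible k S* × (∀ S → Feasible k S → f S ≤ f S*)

  Objectives : Set (c ⊔ ℓsuc ℓ₂)
  Objectives = ∀ {n} → SetFunction n → Set ℓ₂

  nonNegativeSubmodular : Objectives
  nonNegativeSubmodular f = NonNegative f × Submodular f

  monotoneSubmodular : Objectives
  monotoneSubmodular f = NonNegative f × Submodular f × Monotone f

  -- An online algorithm learns k at the start.  When the i-th element arrives it
  -- sees the objective on subsets of the first i elements only, and updates an
  -- internal state, from which its current solution can be read off.
  record OnlineAlgorithm : Set (ℓsuc (c ⊔ ℓ₂)) where
    field
      State    : ℕ → Set c
      start    : ℕ → State 0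
      step     : ∀ {i} → SetFunction (suc i) → State i → Random (State (suc i))
      solution : ∀ {i} → State i → Subset i

    run : ∀ {n} → ℕ → SetFunction n → Random (State n)
    run {zero}  k f = return (start k)
    run {suc n} k f = run k (restrict f) >>= step f

    -- Q holds surely between the states before and after each arrival.
    AtEachArrival : ∀ {q n} → (∀ {i} → State i → State (suc i) → Set q) →
                    ℕ → SetFunction n → Set q
    AtEachArrival {n = zero}  Q k f = ⊤
    AtEachArrival {n = suc n} Q k f =
      AtEachArrival Q k (restrict f) ×
      Surely (λ s → Surely (Q s) (step f s)) (run k (restrict f))

    MaintainsFeasibility : ∀ {n} → ℕ → SetFunction n → Set
    MaintainsFeasibility k = AtEachArrival
      (λ s s′ → solution s′ ⊆ inside ∷ solution s × Feasible k (solution s′)) k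

  Competitive : OnlineAlgorithm → Objectives → Carrier → Set (c ⊔ ℓ₂)
  Competitive A 𝓕 α = ∀ n k (f : SetFunction n) → k ℕ.≤ n → 𝓕 f →
    MaintainsFeasibility k f ×
    (∀ S* → IsOptimal k f S* → α * f S* ≤ 𝔼 (f ∘ solution) (run k f))
    where open OnlineAlgorithm A

  record Memory : Set c where
    constructor memory
    field
      k    : ℕ
      ints : ℕ → ℕ → ℕ
      nums : ℕ → ℕ → Carrier

  update : ∀ {a} {A : Set a} → (ℕ → ℕ → A) → ℕ → ℕ → A → (ℕ → ℕ → A)
  update M x e v x′ e′ = if (x ≡ᵇ x′) ∧ (e ≡ᵇ e′) then v else M x′ e′

  setInts : Memory → ℕ → ℕ → ℕ → Memory
  setInts (memory k ints nums) x e v = memory k (update ints x e v) nums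

  setNums : Memory → ℕ → ℕ → Carrier → Memory
  setNums (memory k ints nums) x e v = memory k ints (update nums x e v)

  -- {u_j : 1 ≤ j ≤ i, a j ≠ 0}
  selected : (ℕ → ℕ) → ∀ i → Subset i
  selected a zero    = []
  selected a (suc i) = not (a (suc i) ≡ᵇ 0) ∷ selected a i

  tossCoin : ∀ {a} {A : Set a} → Carrier → A → A → Random A
  tossCoin p heads tails with 0# ≤? p | p ≤? 1#
  ... | yes 0≤p | yes p≤1 = coin p 0≤p p≤1 (return heads) (return tails)
  ... | yes _   | no _    = return heads
  ... | no _    | _       = return tails

  record Config (m : Mode) : Set c where
    constructor config
    field
      code  : Program m
      store : Memory

  module Execution {i : ℕ} (f : SetFunction i) where

    ⟦_⟧ⁱ : IntExp → Memory → ℕ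
    ⟦ lit v    ⟧ⁱ M = v
    ⟦ capacity ⟧ⁱ M = Memory.k M
    ⟦ revealed ⟧ⁱ M = i
    ⟦ int x e  ⟧ⁱ M = Memory.ints M x (⟦ e ⟧ⁱ M)
    ⟦ d ⊕ e    ⟧ⁱ M = ⟦ d ⟧ⁱ M ℕ.+ ⟦ e ⟧ⁱ M
    ⟦ d ⊖ e    ⟧ⁱ M = ⟦ d ⟧ⁱ M ℕ.∸ ⟦ e ⟧ⁱ M
    ⟦ d ⊗ e    ⟧ⁱ M = ⟦ d ⟧ⁱ M ℕ.* ⟦ e ⟧ⁱ M

    ⟦_⟧ⁿ : NumExp → Memory → Carrier
    ⟦ fromInt e ⟧ⁿ M = fromℕ (⟦ e ⟧ⁱ M)
    ⟦ num x e   ⟧ⁿ M = Memory.nums M x (⟦ e ⟧ⁱ M)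
    ⟦ r ⊞ s     ⟧ⁿ M = ⟦ r ⟧ⁿ M + ⟦ s ⟧ⁿ M
    ⟦ r ⊟ s     ⟧ⁿ M = ⟦ r ⟧ⁿ M - ⟦ s ⟧ⁿ M
    ⟦ r ⊛ s     ⟧ⁿ M = ⟦ r ⟧ⁿ M * ⟦ s ⟧ⁿ M
    ⟦ r ⊘ s     ⟧ⁿ M = ⟦ r ⟧ⁿ M ÷ ⟦ s ⟧ⁿ M

    ⟦_⟧ᵗ : Test → Memory → Bool
    ⟦ d ≤ⁱ e  ⟧ᵗ M = ⟦ d ⟧ⁱ M ≤ᵇ ⟦ e ⟧ⁱ M
    ⟦ r ≤ⁿ s  ⟧ᵗ M = does (⟦ r ⟧ⁿ M ≤? ⟦ s ⟧ⁿ M)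
    ⟦ neg t   ⟧ᵗ M = not (⟦ t ⟧ᵗ M)
    ⟦ t and u ⟧ᵗ M = ⟦ t ⟧ᵗ M ∧ ⟦ u ⟧ᵗ M

    -- The expressions of a command are part of the fixed program, so one step
    -- is a number of elementary operations bounded in terms of the program.
    execute : ∀ {m} → Config m → Random (Config m)
    execute (config [] M) = return (config [] M)
    execute (config (setInt x e d ∷ C) M) =
      return (config C (setInts M x (⟦ e ⟧ⁱ M) (⟦ d ⟧ⁱ M)))
    execute (config (setNum x e r ∷ C) M) =
      return (config C (setNums M x (⟦ e ⟧ⁱ M) (⟦ r ⟧ⁿ M)))
    execute (config (query x e a ∷ C) M) =
      return (config C (setNums M x (⟦ e ⟧ⁱ M) (f (selected (Memory.ints M a) i))))
    execute (config (toss a e r ∷ C) M) =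
      tossCoin (⟦ r ⟧ⁿ M) (config C (setInts M a (⟦ e ⟧ⁱ M) 1))
                          (config C (setInts M a (⟦ e ⟧ⁱ M) 0))
    execute (config (branch t P Q ∷ C) M) =
      return (config ((if ⟦ t ⟧ᵗ M then P else Q) ++ C) M)
    execute (config (while t P ∷ C) M) =
      return (config (if ⟦ t ⟧ᵗ M then P ++ while t P ∷ C else C) M)

    executeFor : ∀ {m} → ℕ → Config m → Random (Config m)
    executeFor zero    χ = return χ
    executeFor (suc t) χ = execute χ >>= executeFor t

  -- Memory is all zeros at the start and persists between arrivals.  When the
  -- i-th element arrives, the program is started afresh and allowed `budget i`
  -- steps; afterwards integer array 0 describes the current solution.
  implementedBy : ∀ {m} → Program m → (budget : ℕ → ℕ) → OnlineAlgorithm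
  implementedBy {m} P budget = record
    { State    = λ _ → Config m
    ; start    = λ k → config [] (memory k (λ _ _ → 0) (λ _ _ → 0#))
    ; step     = λ {i} f χ → Execution.executeFor f (budget (suc i))
                               (config P (Config.store χ))
    ; solution = λ {i} χ → selected (Memory.ints (Config.store χ) 0) i
    }

  HaltsWithin : ∀ {m} → (budget : ℕ → ℕ) → Program m → Objectives → Set (c ⊔ ℓ₂)
  HaltsWithin budget P 𝓕 = ∀ n k (f : SetFunction n) → k ℕ.≤ n → 𝓕 f →
    OnlineAlgorithm.AtEachArrival (implementedBy P budget)
      (λ _ χ → Config.code χ ≡ []) k f

  PolynomialTimeCompetitive : ∀ {m} → Program m → Objectives → Carrier → Set (c ⊔ ℓ₂)
  PolynomialTimeCompetitive P 𝓕 α = ∃₂ λ a d →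
    let budget = λ i → a ℕ.* i ℕ.^ d in
    HaltsWithin budget P 𝓕 × Competitive (implementedBy P budget) 𝓕 α

-- Let A be the set of all elements accepted so far.  A new element u passes if
-- f (A ∪ u) - f A ≥ c * f A / k, where c = a / b; it is then accepted with
-- probability q, and the solution S consists of the k most recently accepted
-- elements.  Every acceptance multiplies f A by at least 1 + c / k, so by
-- Bernoulli's inequality the part of A dropped from S has value at most
-- f A / (1 + c), and submodularity gives f S ≥ c / (1 + c) * f A.  An element of
-- a competing set O that fails the test has marginal value at most c * f A / k,
-- and one that passes is paid for, in expectation, by the growth of f A / q;
-- hence 𝔼 f (O ∪ A) ≤ (c + 1 / q) * 𝔼 f A.  On the other hand
-- 𝔼 f (O ∪ A) ≥ (1 - q) * f O, and f (O ∪ A) ≥ f O if f is monotone.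
--
-- The resulting ratio is c q (1 - q) / ((1 + c) (1 + c q)) in general, which is
-- 9/100 > 56/627 for c = 3/2 and q = 2/5, and c / (1 + c)² = 1/4 in the monotone
-- case with q = c = 1.  A bounded number of operations per arrival suffices:
-- accepted elements are kept in a queue, and no expectation has to be estimated.
module Submission where

import Algebra.Properties.Ring
import Algebra.Properties.Semiring.Mult
import Algebra.Solver.Ring
open import Algebra.Solver.Ring.AlmostCommutativeRing
  using (_-Raw-AlmostCommutative⟶_; fromCommutativeRing)
open import Data.Bool.Base using (Bool; true; false; not; if_then_else_)
open import Data.Fin.Subset using (Subset; inside; outside; _⊆_; _∪_; _∩_; ∣_∣; ⊥)
import Data.Fin.Subset.Properties as Subsetₚ
open import Data.Integer.Base as ℤ using (ℤ; +_; -[1+_])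
import Data.Integer.Properties as ℤₚ
open import Data.List.Base using ([]; _∷_; _++_)
open import Data.Maybe.Base using (Maybe; just; nothing)
open import Data.Nat.Base as ℕ using (ℕ; zero; suc; _≡ᵇ_; _∸_)
import Data.Nat.Properties as ℕₚ
open import Data.Product.Base using (_×_; _,_; proj₁; proj₂; ∃₂; Σ-syntax)
open import Data.Sum.Base using (_⊎_; inj₁; inj₂; [_,_])
open import Data.Unit.Polymorphic.Base using (⊤; tt)
open import Data.Vec.Base using ([]; _∷_)
open import Function.Base using (_∘_; id)
open import Level using (_⊔_)
open import Relation.Binary.PropositionalEquality as ≡ using (_≡_)
import Relation.Binary.Reasoning.Setoid
open import Relation.Binary.Structures using (IsDecTotalOrder)
open import Relation.Nullary using (¬_; Dec; yes; no; does; contradiction)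
open import Defs

-- Arithmetic of ordered fields, with a ring solver over integer coefficients.

module OrderedFieldProperties {c ℓ₁ ℓ₂} (ℝ : ArchimedeanOrderedField c ℓ₁ ℓ₂) where

  open ArchimedeanOrderedField ℝ
  open IsDecTotalOrder isDecTotalOrder public
    using (total)
    renaming (trans to ≤-trans; reflexive to ≤-reflexive; antisym to ≤-antisym; refl to ≤-refl)
  open Algebra.Properties.Ring ring
    using (-‿distribˡ-*; -‿distribʳ-*; -‿involutive; -0#≈0#; -‿anti-homo-+)
  open Algebra.Properties.Semiring.Mult semiring using (×-homo-+; ×1-homo-*)

  fromℕ-+ : ∀ m n → fromℕ (m ℕ.+ n) ≈ fromℕ m + fromℕ n
  fromℕ-+ = ×-homo-+ 1#

  fromℕ-* : ∀ m n → fromℕ (m ℕ.* n) ≈ fromℕ m * fromℕ n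
  fromℕ-* = ×1-homo-*

  fromℤ : ℤ → Carrier
  fromℤ (+ n)    = fromℕ n
  fromℤ -[1+ n ] = - fromℕ (suc n)

  private
    open module ≈-Reasoning = Relation.Binary.Reasoning.Setoid setoid

    cancel-1+ : ∀ x y → (1# + x) - (1# + y) ≈ x - y
    cancel-1+ x y = begin
      (1# + x) + - (1# + y)      ≈⟨ +-cong (+-comm 1# x) (-‿anti-homo-+ 1# y) ⟩
      (x + 1#) + (- y + - 1#)    ≈⟨ +-congˡ (+-comm (- y) (- 1#)) ⟩
      (x + 1#) + (- 1# + - y)    ≈⟨ +-assoc x 1# _ ⟩
      x + (1# + (- 1# + - y))    ≈⟨ +-congˡ (sym (+-assoc 1# (- 1#) (- y))) ⟩
      x + ((1# + - 1#) + - y)    ≈⟨ +-congˡ (+-congʳ (-‿inverseʳ 1#)) ⟩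
      x + (0# + - y)             ≈⟨ +-congˡ (+-identityˡ (- y)) ⟩
      x + - y                    ∎

  fromℤ-⊖ : ∀ m n → fromℤ (m ℤ.⊖ n) ≈ fromℕ m - fromℕ n
  fromℤ-⊖ zero    zero    = sym (-‿inverseʳ 0#)
  fromℤ-⊖ zero    (suc n) = sym (+-identityˡ _)
  fromℤ-⊖ (suc m) zero    = sym (trans (+-congˡ -0#≈0#) (+-identityʳ _))
  fromℤ-⊖ (suc m) (suc n) = begin
    fromℤ (suc m ℤ.⊖ suc n)        ≡⟨ ≡.cong fromℤ (ℤₚ.[1+m]⊖[1+n]≡m⊖n m n) ⟩
    fromℤ (m ℤ.⊖ n)                ≈⟨ fromℤ-⊖ m n ⟩
    fromℕ m - fromℕ n              ≈⟨ cancel-1+ (fromℕ m) (fromℕ n) ⟨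
    fromℕ (suc m) - fromℕ (suc n)  ∎

  fromℤ-neg : ∀ i → fromℤ (ℤ.- i) ≈ - fromℤ i
  fromℤ-neg (+ zero)  = sym -0#≈0#
  fromℤ-neg (+ suc n) = refl
  fromℤ-neg -[1+ n ]  = sym (-‿involutive _)

  fromℤ-+ : ∀ i j → fromℤ (i ℤ.+ j) ≈ fromℤ i + fromℤ j
  fromℤ-+ (+ m)    (+ n)    = fromℕ-+ m n
  fromℤ-+ (+ m)    -[1+ n ] = fromℤ-⊖ m (suc n)
  fromℤ-+ -[1+ m ] (+ n)    = trans (fromℤ-⊖ n (suc m)) (+-comm _ _)
  fromℤ-+ -[1+ m ] -[1+ n ] = begin
    - fromℕ (suc (suc (m ℕ.+ n)))       ≡⟨ ≡.cong (λ k → - fromℕ (suc k)) (≡.sym (ℕₚ.+-suc m n)) ⟩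
    - fromℕ (suc m ℕ.+ suc n)           ≈⟨ -‿cong (fromℕ-+ (suc m) (suc n)) ⟩
    - (fromℕ (suc m) + fromℕ (suc n))   ≈⟨ -‿anti-homo-+ _ _ ⟩
    - fromℕ (suc n) + - fromℕ (suc m)   ≈⟨ +-comm _ _ ⟩
    - fromℕ (suc m) + - fromℕ (suc n)   ∎

  fromℤ-pos-* : ∀ m j → fromℤ (+ m ℤ.* j) ≈ fromℕ m * fromℤ j
  fromℤ-pos-* m (+ n)    = begin
    fromℤ (+ m ℤ.* + n)  ≡⟨ ≡.cong fromℤ (≡.sym (ℤₚ.pos-* m n)) ⟩
    fromℕ (m ℕ.* n)      ≈⟨ fromℕ-* m n ⟩
    fromℕ m * fromℕ n    ∎
  fromℤ-pos-* m -[1+ n ] = begin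
    fromℤ (+ m ℤ.* -[1+ n ])          ≡⟨ ≡.cong fromℤ (≡.sym (ℤₚ.neg-distribʳ-* (+ m) (+ suc n))) ⟩
    fromℤ (ℤ.- (+ m ℤ.* + suc n))     ≈⟨ fromℤ-neg (+ m ℤ.* + suc n) ⟩
    - fromℤ (+ m ℤ.* + suc n)         ≈⟨ -‿cong (fromℤ-pos-* m (+ suc n)) ⟩
    - (fromℕ m * fromℕ (suc n))       ≈⟨ -‿distribʳ-* _ _ ⟩
    fromℕ m * - fromℕ (suc n)         ∎

  fromℤ-* : ∀ i j → fromℤ (i ℤ.* j) ≈ fromℤ i * fromℤ j
  fromℤ-* (+ m)    j = fromℤ-pos-* m j
  fromℤ-* -[1+ m ] j = begin
    fromℤ (-[1+ m ] ℤ.* j)          ≡⟨ ≡.cong fromℤ (≡.sym (ℤₚ.neg-distribˡ-* (+ suc m) j)) ⟩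
    fromℤ (ℤ.- (+ suc m ℤ.* j))     ≈⟨ fromℤ-neg (+ suc m ℤ.* j) ⟩
    - fromℤ (+ suc m ℤ.* j)         ≈⟨ -‿cong (fromℤ-pos-* (suc m) j) ⟩
    - (fromℕ (suc m) * fromℤ j)     ≈⟨ -‿distribˡ-* _ _ ⟩
    - fromℕ (suc m) * fromℤ j       ∎

  -- Agrees with fromℤ, but sends the literal 1 to 1# itself rather than to
  -- 1# + 0#, so that the solver can be given expressions containing 1#.
  ⟦_⟧ℤ : ℤ → Carrier
  ⟦ + 1 ⟧ℤ = 1#
  ⟦ i   ⟧ℤ = fromℤ i

  ⟦⟧ℤ≈fromℤ : ∀ i → ⟦ i ⟧ℤ ≈ fromℤ i
  ⟦⟧ℤ≈fromℤ (+ 0)           = refl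
  ⟦⟧ℤ≈fromℤ (+ 1)           = sym (+-identityʳ 1#)
  ⟦⟧ℤ≈fromℤ (+ suc (suc n)) = refl
  ⟦⟧ℤ≈fromℤ -[1+ n ]        = refl

  ⟦⟧ℤ-homomorphism : ℤ.+-*-rawRing -Raw-AlmostCommutative⟶ fromCommutativeRing commutativeRing
  ⟦⟧ℤ-homomorphism = record
    { ⟦_⟧    = ⟦_⟧ℤ
    ; +-homo = λ i j → trans (⟦⟧ℤ≈fromℤ (i ℤ.+ j))
        (trans (fromℤ-+ i j) (sym (+-cong (⟦⟧ℤ≈fromℤ i) (⟦⟧ℤ≈fromℤ j))))
    ; *-homo = λ i j → trans (⟦⟧ℤ≈fromℤ (i ℤ.* j))
        (trans (fromℤ-* i j) (sym (*-cong (⟦⟧ℤ≈fromℤ i) (⟦⟧ℤ≈fromℤ j))))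
    ; -‿homo = λ i → trans (⟦⟧ℤ≈fromℤ (ℤ.- i))
        (trans (fromℤ-neg i) (sym (-‿cong (⟦⟧ℤ≈fromℤ i))))
    ; 0-homo = refl
    ; 1-homo = refl
    }

  ⟦⟧ℤ-≟ : ∀ i j → Maybe (⟦ i ⟧ℤ ≈ ⟦ j ⟧ℤ)
  ⟦⟧ℤ-≟ i j with i ℤₚ.≟ j
  ... | yes i≡j = just (reflexive (≡.cong ⟦_⟧ℤ i≡j))
  ... | no  _   = nothing

  module Solver = Algebra.Solver.Ring ℤ.+-*-rawRing
    (fromCommutativeRing commutativeRing) ⟦⟧ℤ-homomorphism ⟦⟧ℤ-≟
  open Solver using (solve; _:=_; _:+_; _:*_; _:-_; con)

  ≤-resp-≈ : ∀ {x x′ y y′} → x ≈ x′ → y ≈ y′ → x ≤ y → x′ ≤ y′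
  ≤-resp-≈ x≈x′ y≈y′ x≤y =
    ≤-trans (≤-reflexive (sym x≈x′)) (≤-trans x≤y (≤-reflexive y≈y′))

  0≤y-x : ∀ {x y} → x ≤ y → 0# ≤ y - x
  0≤y-x {x} {y} x≤y = ≤-resp-≈ (-‿inverseʳ x) refl (+-monoˡ-≤ (- x) x≤y)

  -- The form of most inequalities below: the slack `d` is exhibited as a sum of nonnegative terms,
  -- and the identity is left to the ring solver.
  ≤-by : ∀ {d x y} → 0# ≤ d → y ≈ x + d → x ≤ y
  ≤-by {d} {x} {y} 0≤d y≈x+d =
    ≤-resp-≈ (+-identityˡ x) (trans (+-comm d x) (sym y≈x+d)) (+-monoˡ-≤ x 0≤d)

  +-mono-≤ : ∀ {x y u v} → x ≤ y → u ≤ v → x + u ≤ y + v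
  +-mono-≤ {x} {y} {u} {v} x≤y u≤v = ≤-trans (+-monoˡ-≤ u x≤y)
    (≤-resp-≈ (+-comm u y) (+-comm v y) (+-monoˡ-≤ y u≤v))

  +-nonNeg : ∀ {x y} → 0# ≤ x → 0# ≤ y → 0# ≤ x + y
  +-nonNeg 0≤x 0≤y = ≤-resp-≈ (+-identityˡ 0#) refl (+-mono-≤ 0≤x 0≤y)

  *-monoˡ-≤ : ∀ {z x y} → 0# ≤ z → x ≤ y → z * x ≤ z * y
  *-monoˡ-≤ {z} {x} {y} 0≤z x≤y = ≤-by (*-nonNeg 0≤z (0≤y-x x≤y))
    (solve 3 (λ z x y → z :* y := z :* x :+ z :* (y :- x)) refl z x y)

  0≤1 : 0# ≤ 1#
  0≤1 with total 0# 1#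
  ... | inj₁ p = p
  ... | inj₂ p = ≤-by (*-nonNeg (0≤y-x p) (0≤y-x p))
    (solve 0 (con (+ 1) := con (+ 0) :+ (con (+ 0) :- con (+ 1)) :* (con (+ 0) :- con (+ 1))) refl)

  fromℕ-nonNeg : ∀ n → 0# ≤ fromℕ n
  fromℕ-nonNeg zero    = ≤-refl
  fromℕ-nonNeg (suc n) = +-nonNeg 0≤1 (fromℕ-nonNeg n)

  fromℕ-mono : ∀ {m n} → m ℕ.≤ n → fromℕ m ≤ fromℕ n
  fromℕ-mono {n = n} ℕ.z≤n  = fromℕ-nonNeg n
  fromℕ-mono (ℕ.s≤s m≤n) = +-mono-≤ ≤-refl (fromℕ-mono m≤n)

  1≤fromℕ-suc : ∀ n → 1# ≤ fromℕ (suc n)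
  1≤fromℕ-suc n = ≤-by (fromℕ-nonNeg n) refl

  fromℕ-suc≉0 : ∀ n → ¬ fromℕ (suc n) ≈ 0#
  fromℕ-suc≉0 n eq = 0≉1 (≤-antisym 0≤1 (≤-trans (1≤fromℕ-suc n) (≤-reflexive eq)))

  fromℕ-pos : ∀ n .{{_ : ℕ.NonZero n}} → 0# < fromℕ n
  fromℕ-pos (suc n) = fromℕ-nonNeg (suc n) , λ eq → fromℕ-suc≉0 n (sym eq)

  *-pos : ∀ {x y} → 0# < x → 0# < y → 0# < x * y
  *-pos {x} {y} (0≤x , 0≉x) (0≤y , 0≉y) = *-nonNeg 0≤x 0≤y , λ 0≈xy →
    let x⁻¹ , x*x⁻¹≈1 = inverse x (λ x≈0 → 0≉x (sym x≈0)) in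
    0≉y (begin
      0#              ≈⟨ zeroʳ x⁻¹ ⟨
      x⁻¹ * 0#        ≈⟨ *-congˡ 0≈xy ⟩
      x⁻¹ * (x * y)   ≈⟨ solve 3 (λ x x⁻¹ y → x⁻¹ :* (x :* y) := (x :* x⁻¹) :* y) refl x x⁻¹ y ⟩
      (x * x⁻¹) * y   ≈⟨ *-congʳ x*x⁻¹≈1 ⟩
      1# * y          ≈⟨ *-identityˡ y ⟩
      y               ∎)

  *-cancelˡ-≤ : ∀ {z x y} → 0# < z → z * x ≤ z * y → x ≤ y
  *-cancelˡ-≤ {z} {x} {y} (0≤z , 0≉z) zx≤zy with total x y
  ... | inj₁ x≤y = x≤y
  -- Here the two products bound each other, hence are equal, and the inverse of `z` cancels.
  ... | inj₂ y≤x = ≤-reflexive (begin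
    x                ≈⟨ *-identityˡ x ⟨
    1# * x           ≈⟨ *-congʳ z*z⁻¹≈1 ⟨
    (z * z⁻¹) * x    ≈⟨ solve 3 (λ z z⁻¹ x → (z :* z⁻¹) :* x := z⁻¹ :* (z :* x)) refl z z⁻¹ x ⟩
    z⁻¹ * (z * x)    ≈⟨ *-congˡ (≤-antisym zx≤zy (*-monoˡ-≤ 0≤z y≤x)) ⟩
    z⁻¹ * (z * y)    ≈⟨ solve 3 (λ z z⁻¹ x → z⁻¹ :* (z :* x) := (z :* z⁻¹) :* x) refl z z⁻¹ y ⟩
    (z * z⁻¹) * y    ≈⟨ *-congʳ z*z⁻¹≈1 ⟩
    1# * y           ≈⟨ *-identityˡ y ⟩
    y                ∎)
    where
    z⁻¹ = proj₁ (inverse z (λ z≈0 → 0≉z (sym z≈0)))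
    z*z⁻¹≈1 = proj₂ (inverse z (λ z≈0 → 0≉z (sym z≈0)))

  *-÷-cancel : ∀ x {y} → 0# < y → y * (x ÷ y) ≈ x
  *-÷-cancel x {y} (_ , 0≉y) with y ≟ 0#
  ... | yes y≈0 = contradiction (sym y≈0) 0≉y
  ... | no  y≉0 = begin
    y * (x * y⁻¹)   ≈⟨ solve 3 (λ x y y⁻¹ → y :* (x :* y⁻¹) := x :* (y :* y⁻¹)) refl x y y⁻¹ ⟩
    x * (y * y⁻¹)   ≈⟨ *-congˡ (proj₂ (inverse y y≉0)) ⟩
    x * 1#          ≈⟨ *-identityʳ x ⟩
    x               ∎
    where y⁻¹ = proj₁ (inverse y y≉0)

  -- Used with a / b the ratio that the analysis yields and m / n the ratio claimed. Multiplying by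
  -- n b reduces their comparison to one of naturals.
  fraction-≤ : ∀ m n a b .{{_ : ℕ.NonZero n}} .{{_ : ℕ.NonZero b}} {x y} →
               m ℕ.* b ℕ.≤ n ℕ.* a → 0# ≤ x →
               fromℕ a * x ≤ fromℕ b * y → (fromℕ m ÷ fromℕ n) * x ≤ y
  fraction-≤ m n a b {x} {y} mb≤na 0≤x ax≤by =
    *-cancelˡ-≤ (*-pos (fromℕ-pos n) (fromℕ-pos b)) (≤-trans (≤-reflexive lhs)
      (≤-trans middle (≤-reflexive (sym (*-assoc _ _ y)))))
    where
    q = fromℕ m ÷ fromℕ n

    lhs : (fromℕ n * fromℕ b) * (q * x) ≈ x * fromℕ (m ℕ.* b)
    lhs = begin
      (fromℕ n * fromℕ b) * (q * x)   ≈⟨ solve 4 (λ n b q x → (n :* b) :* (q :* x) := x :* ((n :* q) :* b))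
                                           refl (fromℕ n) (fromℕ b) q x ⟩
      x * ((fromℕ n * q) * fromℕ b)   ≈⟨ *-congˡ (*-congʳ (*-÷-cancel (fromℕ m) (fromℕ-pos n))) ⟩
      x * (fromℕ m * fromℕ b)         ≈⟨ *-congˡ (fromℕ-* m b) ⟨
      x * fromℕ (m ℕ.* b)             ∎

    middle : x * fromℕ (m ℕ.* b) ≤ fromℕ n * (fromℕ b * y)
    middle = ≤-trans (*-monoˡ-≤ 0≤x (fromℕ-mono mb≤na)) (≤-trans
      (≤-reflexive (trans (*-congˡ (fromℕ-* n a))
        (solve 3 (λ x n a → x :* (n :* a) := n :* (a :* x)) refl x (fromℕ n) (fromℕ a))))
      (*-monoˡ-≤ (fromℕ-nonNeg n) ax≤by))

-- Index comparison, then recency and removal by arrival time in a subset.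

<⇒≡ᵇ-false : ∀ {m n} → m ℕ.< n → (m ≡ᵇ n) ≡ false
<⇒≡ᵇ-false {zero}  {suc n} _           = ≡.refl
<⇒≡ᵇ-false {suc m} {suc n} (ℕ.s≤s m<n) = <⇒≡ᵇ-false m<n

>⇒≡ᵇ-false : ∀ {m n} → n ℕ.< m → (m ≡ᵇ n) ≡ false
>⇒≡ᵇ-false {suc m} {zero}  _           = ≡.refl
>⇒≡ᵇ-false {suc m} {suc n} (ℕ.s≤s n<m) = >⇒≡ᵇ-false n<m

≡ᵇ-refl : ∀ n → (n ≡ᵇ n) ≡ true
≡ᵇ-refl zero    = ≡.refl
≡ᵇ-refl (suc n) = ≡ᵇ-refl n

-- Subsets list the newest element first, so for a history `A` of accepted elements `latest k A` is
-- the solution and `earlier k A` the part already dropped.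
latest earlier : ∀ {n} → ℕ → Subset n → Subset n
latest k       []            = []
latest k       (outside ∷ A) = outside ∷ latest k A
latest zero    (inside ∷ A)  = outside ∷ latest zero A
latest (suc k) (inside ∷ A)  = inside ∷ latest k A
earlier k       []            = []
earlier k       (outside ∷ A) = outside ∷ earlier k A
earlier zero    (inside ∷ A)  = inside ∷ earlier zero A
earlier (suc k) (inside ∷ A)  = outside ∷ earlier k A

∣latest∣≤ : ∀ {n} k (A : Subset n) → ∣ latest k A ∣ ℕ.≤ k
∣latest∣≤ k       []            = ℕ.z≤n
∣latest∣≤ k       (outside ∷ A) = ∣latest∣≤ k A
∣latest∣≤ zero    (inside ∷ A)  = ∣latest∣≤ zero A
∣latest∣≤ (suc k) (inside ∷ A)  = ℕ.s≤s (∣latest∣≤ k A)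

latest-⊆-suc : ∀ {n} k (A : Subset n) → latest k A ⊆ latest (suc k) A
latest-⊆-suc k       []            = Subsetₚ.⊆-refl
latest-⊆-suc k       (outside ∷ A) = Subsetₚ.out⊆ (latest-⊆-suc k A)
latest-⊆-suc zero    (inside ∷ A)  = Subsetₚ.out⊆ Subsetₚ.⊆-refl
latest-⊆-suc (suc k) (inside ∷ A)  = Subsetₚ.in⊆in (latest-⊆-suc k A)

-- Dropped elements do not return, because an acceptance only moves the window of the k most recent
-- elements forward.
latest-∷-⊆ : ∀ {n} k b (A : Subset n) → latest k (b ∷ A) ⊆ inside ∷ latest k A
latest-∷-⊆ k       outside A = Subsetₚ.out⊆ Subsetₚ.⊆-refl
latest-∷-⊆ zero    inside  A = Subsetₚ.out⊆ Subsetₚ.⊆-refl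
latest-∷-⊆ (suc k) inside  A = Subsetₚ.in⊆in (latest-⊆-suc k A)

earlier-zero : ∀ {n} (A : Subset n) → earlier zero A ≡ A
earlier-zero []            = ≡.refl
earlier-zero (outside ∷ A) = ≡.cong (outside ∷_) (earlier-zero A)
earlier-zero (inside ∷ A)  = ≡.cong (inside ∷_) (earlier-zero A)

latest-all : ∀ {n} k (A : Subset n) → ∣ A ∣ ℕ.≤ k → latest k A ≡ A
latest-all k       []            _              = ≡.refl
latest-all k       (outside ∷ A) ∣A∣≤k          = ≡.cong (outside ∷_) (latest-all k A ∣A∣≤k)
latest-all (suc k) (inside ∷ A)  (ℕ.s≤s ∣A∣≤k)  = ≡.cong (inside ∷_) (latest-all k A ∣A∣≤k)

latest∪earlier : ∀ {n} k (A : Subset n) → latest k A ∪ earlier k A ≡ A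
latest∪earlier k       []            = ≡.refl
latest∪earlier k       (outside ∷ A) = ≡.cong (outside ∷_) (latest∪earlier k A)
latest∪earlier zero    (inside ∷ A)  = ≡.cong (inside ∷_) (latest∪earlier zero A)
latest∪earlier (suc k) (inside ∷ A)  = ≡.cong (inside ∷_) (latest∪earlier k A)

-- The 1-based arrival time of the (k+1)-st most recent element; 0 if there is
-- none.
time : ∀ {n} → ℕ → Subset n → ℕ
time k       []            = 0
time k       (outside ∷ A) = time k A
time {suc n} zero (inside ∷ A) = suc n
time (suc k) (inside ∷ A)  = time k A

time≤ : ∀ {n} k (A : Subset n) → time k A ℕ.≤ n
time≤ k       []            = ℕ.z≤n
time≤ k       (outside ∷ A) = ℕₚ.m≤n⇒m≤1+n (time≤ k A)
time≤ zero    (inside ∷ A)  = ℕₚ.≤-refl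
time≤ (suc k) (inside ∷ A)  = ℕₚ.m≤n⇒m≤1+n (time≤ k A)

-- Elements are addressed by 1-based arrival time, as in `time`. Time 0 thus removes nothing, which
-- is the case of a solution with room left.
remove : ∀ {n} → ℕ → Subset n → Subset n
remove         e []      = []
remove {suc n} e (b ∷ A) = (if e ≡ᵇ suc n then outside else b) ∷ remove e A

remove-> : ∀ {n e} (A : Subset n) → n ℕ.< e → remove e A ≡ A
remove->     []      n<e = ≡.refl
remove-> {e = e} (b ∷ A) n<e rewrite >⇒≡ᵇ-false n<e =
  ≡.cong (b ∷_) (remove-> A (ℕₚ.<-trans (ℕₚ.n<1+n _) n<e))

remove-≤ : ∀ {n e} b (A : Subset n) → e ℕ.≤ n → remove e (b ∷ A) ≡ b ∷ remove e A
remove-≤ b A e≤n rewrite <⇒≡ᵇ-false (ℕ.s≤s e≤n) = ≡.refl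

remove-top : ∀ {n} b (A : Subset n) → remove (suc n) (b ∷ A) ≡ outside ∷ A
remove-top {n} b A rewrite ≡ᵇ-refl n = ≡.cong (outside ∷_) (remove-> A (ℕₚ.n<1+n n))

remove-oldest : ∀ {n} k (A : Subset n) → remove (time k A) (latest (suc k) A) ≡ latest k A
remove-oldest k       []            = ≡.refl
remove-oldest k       (outside ∷ A) =
  ≡.trans (remove-≤ outside _ (time≤ k A)) (≡.cong (outside ∷_) (remove-oldest k A))
remove-oldest zero    (inside ∷ A)  = remove-top inside _
remove-oldest (suc k) (inside ∷ A)  =
  ≡.trans (remove-≤ inside _ (time≤ k A)) (≡.cong (inside ∷_) (remove-oldest k A))

-- One removal suffices to update the solution: the element leaving the window is the (k+1)-st most
-- recent of the enlarged history. For k = 0 it is the new element itself.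
latest-inside : ∀ {n} k (A : Subset n) →
                remove (time k (inside ∷ A)) (inside ∷ latest k A) ≡ latest k (inside ∷ A)
latest-inside zero    A = remove-top inside _
latest-inside (suc k) A =
  ≡.trans (remove-≤ inside _ (time≤ k A)) (≡.cong (inside ∷_) (remove-oldest k A))

p⊆q⇒p∪q≡q : ∀ {n} {p q : Subset n} → p ⊆ q → p ∪ q ≡ q
p⊆q⇒p∪q≡q {p = p} {q} p⊆q = Subsetₚ.⊆-antisym
  (λ x∈ → [ p⊆q , id ] (Subsetₚ.x∈p∪q⁻ p q x∈)) (Subsetₚ.q⊆p∪q p q)

p⊆q⇒p∩q≡p : ∀ {n} {p q : Subset n} → p ⊆ q → p ∩ q ≡ p
p⊆q⇒p∩q≡p {p = p} {q} p⊆q = Subsetₚ.⊆-antisym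
  (Subsetₚ.p∩q⊆p p q) (λ x∈p → Subsetₚ.x∈p∩q⁺ (x∈p , p⊆q x∈p))

∣p∣≤0⇒p≡⊥ : ∀ {n} (p : Subset n) → ∣ p ∣ ℕ.≤ 0 → p ≡ ⊥
∣p∣≤0⇒p≡⊥ []            _     = ≡.refl
∣p∣≤0⇒p≡⊥ (outside ∷ p) ∣p∣≤0 = ≡.cong (outside ∷_) (∣p∣≤0⇒p≡⊥ p ∣p∣≤0)

-- Expectations of finite random trees and two-point laws.

module Probability {c ℓ₁ ℓ₂} (ℝ : ArchimedeanOrderedField c ℓ₁ ℓ₂) where

  open ArchimedeanOrderedField ℝ
  open OrderedFieldProperties ℝ
  open Model ℝ
  open Solver using (solve; _:=_; _:+_; _:*_; _:-_; con)

  Surely-map : ∀ {a p q} {A : Set a} {P : A → Set p} {Q : A → Set q} →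
               (∀ x → P x → Q x) → (m : Random A) → Surely P m → Surely Q m
  Surely-map P⇒Q (return x)       px        = P⇒Q x px
  Surely-map P⇒Q (coin _ _ _ s t) (ps , pt) = Surely-map P⇒Q s ps , Surely-map P⇒Q t pt

  Surely->>= : ∀ {a b p} {A : Set a} {B : Set b} {P : B → Set p} {h : A → Random B}
               (m : Random A) → Surely (λ x → Surely P (h x)) m → Surely P (m >>= h)
  Surely->>= (return x)       px        = px
  Surely->>= (coin _ _ _ s t) (ps , pt) = Surely->>= s ps , Surely->>= t pt

  𝔼->>= : ∀ {a b} {A : Set a} {B : Set b} (g : B → Carrier) (m : Random A) (h : A → Random B) →
          𝔼 g (m >>= h) ≡ 𝔼 (𝔼 g ∘ h) m
  𝔼->>= g (return x)       h = ≡.refl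
  𝔼->>= g (coin p _ _ s t) h = ≡.cong₂ (λ u v → p * u + (1# - p) * v) (𝔼->>= g s h) (𝔼->>= g t h)

  𝔼-mono : ∀ {a} {A : Set a} {g h : A → Carrier} (m : Random A) →
           Surely (λ x → g x ≤ h x) m → 𝔼 g m ≤ 𝔼 h m
  𝔼-mono (return x)           g≤h         = g≤h
  𝔼-mono (coin p 0≤p p≤1 s t) (g≤h , g≤h′) =
    +-mono-≤ (*-monoˡ-≤ 0≤p (𝔼-mono s g≤h)) (*-monoˡ-≤ (0≤y-x p≤1) (𝔼-mono t g≤h′))

  𝔼-const : ∀ {a} {A : Set a} u (m : Random A) → 𝔼 (λ _ → u) m ≈ u
  𝔼-const u (return x)       = refl
  𝔼-const u (coin p _ _ s t) = trans (+-cong (*-congˡ (𝔼-const u s)) (*-congˡ (𝔼-const u t)))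
    (solve 2 (λ p u → p :* u :+ (con (+ 1) :- p) :* u := u) refl p u)

  𝔼-linear : ∀ {a} {A : Set a} u v (g h : A → Carrier) (m : Random A) →
             𝔼 (λ x → u * g x + v * h x) m ≈ u * 𝔼 g m + v * 𝔼 h m
  𝔼-linear u v g h (return x)       = refl
  𝔼-linear u v g h (coin p _ _ s t) =
    trans (+-cong (*-congˡ (𝔼-linear u v g h s)) (*-congˡ (𝔼-linear u v g h t)))
      (solve 7 (λ p u v a b a′ b′ →
        p :* (u :* a :+ v :* b) :+ (con (+ 1) :- p) :* (u :* a′ :+ v :* b′) :=
        u :* (p :* a :+ (con (+ 1) :- p) :* a′) :+ v :* (p :* b :+ (con (+ 1) :- p) :* b′))
        refl p u v (𝔼 g s) (𝔼 h s) (𝔼 g t) (𝔼 h t))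

  -- A two-point law given by its expectations and support, not by the shape of the tree, so that a
  -- deterministic command is the case p = 1.
  record Mixture {a} {A : Set a} (p : Carrier) (x y : A) (m : Random A) : Set (c ⊔ ℓ₁ ⊔ a) where
    field
      expectation : ∀ g → 𝔼 g m ≈ p * g x + (1# - p) * g y
      support     : Surely (λ z → z ≡ x ⊎ z ≡ y) m

    surely : ∀ {q} {Q : A → Set q} → Q x → Q y → Surely Q m
    surely {Q = Q} qx qy = Surely-map (λ { _ (inj₁ ≡.refl) → qx ; _ (inj₂ ≡.refl) → qy }) m support

  Mixture->>= : ∀ {a b} {A : Set a} {B : Set b} {p x y x′ y′} {m : Random A} {h : A → Random B} →
                Mixture p x y m → h x ≡ return x′ → h y ≡ return y′ → Mixture p x′ y′ (m >>= h)
  Mixture->>= {p = p} {x} {y} {x′} {y′} {m} {h} mix hx hy = record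
    { expectation = λ g → trans (reflexive (𝔼->>= g m h)) (trans (expectation (𝔼 g ∘ h))
        (+-cong (*-congˡ (reflexive (≡.cong (𝔼 g) hx))) (*-congˡ (reflexive (≡.cong (𝔼 g) hy)))))
    ; support = Surely->>= m (surely
        (≡.subst (Surely _) (≡.sym hx) (inj₁ ≡.refl))
        (≡.subst (Surely _) (≡.sym hy) (inj₂ ≡.refl)))
    }
    where open Mixture mix

  return-mixture : ∀ {a} {A : Set a} (x y : A) → Mixture 1# x y (return x)
  return-mixture x y = record
    { expectation = λ g → solve 2 (λ u v → u := con (+ 1) :* u :+ (con (+ 1) :- con (+ 1)) :* v)
        refl (g x) (g y)
    ; support = inj₁ ≡.refl
    }

  tossCoin-mixture : ∀ {a} {A : Set a} {p} → 0# ≤ p → p ≤ 1# → (x y : A) →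
                     Mixture p x y (tossCoin p x y)
  tossCoin-mixture {p = p} 0≤p p≤1 x y with 0# ≤? p | p ≤? 1#
  ... | yes _   | yes _   = record { expectation = λ _ → refl ; support = inj₁ ≡.refl , inj₂ ≡.refl }
  ... | yes _   | no p≰1  = contradiction p≤1 p≰1
  ... | no 0≰p  | _       = contradiction 0≤p 0≰p

-- Diminishing returns, and the value of the most recent accepted elements.

module Submodularity {c ℓ₁ ℓ₂} (ℝ : ArchimedeanOrderedField c ℓ₁ ℓ₂) where

  open ArchimedeanOrderedField ℝ
  open OrderedFieldProperties ℝ
  open Model ℝ
  open Solver using (solve; _:=_; _:+_; _:*_; _:-_; con)

  restrict-submodular : ∀ {n} {f : SetFunction (suc n)} → Submodular f → Submodular (restrict f)
  restrict-submodular sub S T = sub (outside ∷ S) (outside ∷ T)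

  union-submodular : ∀ {n} {f : SetFunction n} (O : Subset n) →
                     Submodular f → Submodular (λ A → f (O ∪ A))
  union-submodular {f = f} O sub S T = ≤-resp-≈
    (+-cong (reflexive (≡.cong f union)) (reflexive (≡.cong f (≡.sym (Subsetₚ.∪-distribˡ-∩ O S T)))))
    refl (sub (O ∪ S) (O ∪ T))
    where
    union : (O ∪ S) ∪ (O ∪ T) ≡ O ∪ (S ∪ T)
    union = begin
      (O ∪ S) ∪ (O ∪ T)  ≡⟨ Subsetₚ.∪-assoc O S (O ∪ T) ⟩
      O ∪ (S ∪ (O ∪ T))  ≡⟨ ≡.cong (O ∪_) (Subsetₚ.∪-comm S (O ∪ T)) ⟩
      O ∪ ((O ∪ T) ∪ S)  ≡⟨ ≡.sym (Subsetₚ.∪-assoc O (O ∪ T) S) ⟩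
      (O ∪ (O ∪ T)) ∪ S  ≡⟨ ≡.cong (_∪ S) (≡.sym (Subsetₚ.∪-assoc O O T)) ⟩
      ((O ∪ O) ∪ T) ∪ S  ≡⟨ ≡.cong (λ Q → (Q ∪ T) ∪ S) (Subsetₚ.∪-idem O) ⟩
      (O ∪ T) ∪ S        ≡⟨ Subsetₚ.∪-assoc O T S ⟩
      O ∪ (T ∪ S)        ≡⟨ ≡.cong (O ∪_) (Subsetₚ.∪-comm T S) ⟩
      O ∪ (S ∪ T)        ∎
      where open ≡.≡-Reasoning

  -- Submodularity for `A` with the new element and `B` without it: as `A ⊆ B`, the union is `B`
  -- with the new element and the intersection is `A`.
  marginal-decreasing : ∀ {n} {f : SetFunction (suc n)} → Submodular f → ∀ {A B} → A ⊆ B →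
    f (inside ∷ B) + f (outside ∷ A) ≤ f (inside ∷ A) + f (outside ∷ B)
  marginal-decreasing {f = f} sub {A} {B} A⊆B = ≤-resp-≈
    (+-cong (reflexive (≡.cong (f ∘ (inside ∷_)) (p⊆q⇒p∪q≡q A⊆B)))
            (reflexive (≡.cong (f ∘ (outside ∷_)) (p⊆q⇒p∩q≡p A⊆B))))
    refl (sub (inside ∷ A) (outside ∷ B))

  -- The threshold test with denominators cleared: for α = a and κ = b * k the quotient α / κ is c /
  -- k.
  Passes : ∀ {n} → Carrier → Carrier → SetFunction (suc n) → Subset n → Set ℓ₂
  Passes α κ f A = α * f (outside ∷ A) ≤ κ * (f (inside ∷ A) - f (outside ∷ A))

  Growing : ∀ {n} → Carrier → Carrier → SetFunction n → Subset n → Set ℓ₂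
  Growing α κ f []            = ⊤
  Growing α κ f (outside ∷ A) = Growing α κ (restrict f) A
  Growing α κ f (inside ∷ A)  = Growing α κ (restrict f) A × Passes α κ f A

  -- Bernoulli's inequality multiplied by κ. By induction on `A`, the newest element adds at least α
  -- / κ times the value before it, and that value is at least f of `earlier j A`.
  growth : ∀ {n} {α κ} → 0# ≤ α → 0# < κ → (f : SetFunction n) → NonNegative f →
           ∀ A → Growing α κ f A → ∀ j → j ℕ.≤ ∣ A ∣ →
           (κ + fromℕ j * α) * f (earlier j A) ≤ κ * f A
  growth {α = α} {κ} 0≤α 0<κ f 0≤f [] _ zero _ = ≤-reflexive
    (solve 3 (λ κ α y → (κ :+ con (+ 0) :* α) :* y := κ :* y) refl κ α (f []))
  growth 0≤α 0<κ f 0≤f (outside ∷ A) grows j j≤ =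
    growth 0≤α 0<κ (restrict f) (0≤f ∘ (outside ∷_)) A grows j j≤
  growth {α = α} {κ} 0≤α 0<κ f 0≤f (inside ∷ A) _ zero _ = ≤-reflexive (trans
    (*-congˡ (reflexive (≡.cong (f ∘ (inside ∷_)) (earlier-zero A))))
    (solve 3 (λ κ α y → (κ :+ con (+ 0) :* α) :* y := κ :* y) refl κ α (f (inside ∷ A))))
  growth {α = α} {κ} 0≤α 0<κ f 0≤f (inside ∷ A) (grows , pass) (suc j) (ℕ.s≤s j≤) = ≤-by
    (+-nonNeg (+-nonNeg (0≤y-x ih) (0≤y-x pass)) (*-nonNeg 0≤α (0≤y-x e≤x)))
    (solve 6 (λ κ α j e x y → κ :* y :=
      (κ :+ (con (+ 1) :+ j) :* α) :* e :+
      ((κ :* x :- (κ :+ j :* α) :* e) :+ (κ :* (y :- x) :- α :* x) :+ α :* (x :- e)))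
      refl κ α (fromℕ j) (f (outside ∷ earlier j A)) (f (outside ∷ A)) (f (inside ∷ A)))
    where
    ih = growth 0≤α 0<κ (restrict f) (0≤f ∘ (outside ∷_)) A grows j j≤

    e≤x : f (outside ∷ earlier j A) ≤ f (outside ∷ A)
    e≤x = *-cancelˡ-≤ 0<κ (≤-trans (≤-by (*-nonNeg (*-nonNeg (fromℕ-nonNeg j) 0≤α) (0≤f _))
      (solve 4 (λ κ j α e → (κ :+ j :* α) :* e := κ :* e :+ (j :* α) :* e) refl κ (fromℕ j) α _)) ih)

  -- The solution S and the dropped part E cover `A`, so f A ≤ f S + f E, and `growth` with j the
  -- capacity gives (α + β) f E ≤ β f A.
  latest-bound : ∀ {n α β k} → 0# ≤ α → 0# < β → (f : SetFunction n) → NonNegative f → Submodular f →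
                 ∀ A → Growing α (β * fromℕ (suc k)) f A →
                 α * f A ≤ (α + β) * f (latest (suc k) A)
  latest-bound {α = α} {β} {k} 0≤α 0<β f 0≤f sub A grows with ℕₚ.≤-total ∣ A ∣ (suc k)
  ... | inj₁ ∣A∣≤k rewrite latest-all (suc k) A ∣A∣≤k =
    ≤-by (*-nonNeg (proj₁ 0<β) (0≤f A))
      (solve 3 (λ α β x → (α :+ β) :* x := α :* x :+ β :* x) refl α β (f A))
  ... | inj₂ k≤∣A∣ = ≤-by (+-nonNeg (*-nonNeg 0≤α+β (0≤y-x split)) (0≤y-x small))
    (solve 5 (λ α β s e x → (α :+ β) :* s :=
      α :* x :+ ((α :+ β) :* ((s :+ e) :- x) :+ (β :* x :- (α :+ β) :* e)))
      refl α β (f S) (f E) (f A))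
    where
    S = latest (suc k) A
    E = earlier (suc k) A
    κ = fromℕ (suc k)
    0<κ = fromℕ-pos (suc k)
    0≤α+β = +-nonNeg 0≤α (proj₁ 0<β)

    split : f A ≤ f S + f E
    split = ≤-trans (≤-reflexive (reflexive (≡.cong f (≡.sym (latest∪earlier (suc k) A)))))
      (≤-trans (≤-by (0≤f (S ∩ E)) refl) (sub S E))

    small : (α + β) * f E ≤ β * f A
    small = *-cancelˡ-≤ 0<κ (≤-resp-≈
      (solve 4 (λ α β κ e → (β :* κ :+ κ :* α) :* e := κ :* ((α :+ β) :* e)) refl α β κ (f E))
      (solve 3 (λ β κ x → (β :* κ) :* x := κ :* (β :* x)) refl β κ (f A))
      (growth 0≤α (*-pos 0<β 0<κ) f 0≤f A grows (suc k) k≤∣A∣))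

-- The program.

solutionArray historyArray passedArray queueArray scalarArray : ℕ
solutionArray = 0
historyArray  = 1
-- The elements that passed the threshold test, whatever the outcome of their
-- sampling.  The algorithm never reads this array; only the analysis does.
passedArray   = 2
-- Entry j is the j-th element of the history.
queueArray    = 3
scalarArray   = 4

historySize sampleBit : IntExp
historySize = int scalarArray (lit 0)
sampleBit   = int scalarArray (lit 1)

currentValue extendedValue : NumExp
currentValue  = num 0 (lit 0)
extendedValue = num 0 (lit 1)

threshold : ℕ → ℕ → Test
threshold a b = fromInt (lit a) ⊛ currentValue ≤ⁿ
  fromInt (lit b) ⊛ fromInt capacity ⊛ (extendedValue ⊟ currentValue)

module _ {m : Mode} where

  observe accept reject : Program m
  observe =
    setInt solutionArray revealed (lit 0) ∷
    setInt passedArray revealed (lit 0) ∷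
    setInt historyArray revealed (lit 0) ∷
    query 0 (lit 0) historyArray ∷
    setInt historyArray revealed (lit 1) ∷
    query 0 (lit 1) historyArray ∷ []
  -- Entry 0 of the queue stays 0, so nothing is dropped before the solution is
  -- full: the truncated difference of indices is then 0.
  accept =
    setInt scalarArray (lit 0) (historySize ⊕ lit 1) ∷
    setInt queueArray historySize revealed ∷
    setInt solutionArray revealed (lit 1) ∷
    setInt solutionArray (int queueArray (historySize ⊖ capacity)) (lit 0) ∷ []
  reject = setInt historyArray revealed (lit 0) ∷ []

  -- The command `sample` is to set `sampleBit`: a constant assignment yields the deterministic
  -- algorithm, a coin toss the randomized one.
  keepLatest : ℕ → ℕ → Command m → Program m
  keepLatest a b sample =
    observe ++
    branch (threshold a b)
      (setInt passedArray revealed (lit 1) ∷ sample ∷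
       branch (lit 1 ≤ⁱ sampleBit) accept reject ∷ [])
      reject ∷ []

-- Agreement of the program's memory with the abstract sets.

put : ∀ {a} {A : Set a} → (ℕ → A) → ℕ → A → ℕ → A
put M e v e′ = if e ≡ᵇ e′ then v else M e′

module Implementation {c ℓ₁ ℓ₂} (ℝ : ArchimedeanOrderedField c ℓ₁ ℓ₂) where

  open ArchimedeanOrderedField ℝ
  open Model ℝ
  open Probability ℝ
  open Submodularity ℝ

  selected-put-> : ∀ (M : ℕ → ℕ) {e} v {i} → i ℕ.< e → selected (put M e v) i ≡ selected M i
  selected-put-> M v {zero}  i<e = ≡.refl
  selected-put-> M v {suc i} i<e rewrite >⇒≡ᵇ-false i<e =
    ≡.cong (_ ∷_) (selected-put-> M v (ℕₚ.<-trans (ℕₚ.n<1+n i) i<e))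

  selected-put-top : ∀ (M : ℕ → ℕ) i v →
                     selected (put M (suc i) v) (suc i) ≡ not (v ≡ᵇ 0) ∷ selected M i
  selected-put-top M i v rewrite ≡ᵇ-refl i = ≡.cong (_ ∷_) (selected-put-> M v (ℕₚ.n<1+n i))

  selected-put-put : ∀ (M : ℕ → ℕ) i u v →
                     selected (put (put M (suc i) u) (suc i) v) (suc i) ≡ not (v ≡ᵇ 0) ∷ selected M i
  selected-put-put M i u v = ≡.trans (selected-put-top (put M (suc i) u) i v)
    (≡.cong (_ ∷_) (selected-put-> M u (ℕₚ.n<1+n i)))

  selected-put-0 : ∀ (M : ℕ → ℕ) e i → selected (put M e 0) i ≡ remove e (selected M i)
  selected-put-0 M e zero    = ≡.refl
  selected-put-0 M e (suc i) = ≡.cong₂ _∷_ head (selected-put-0 M e i)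
    where
    head : not ((if e ≡ᵇ suc i then 0 else M (suc i)) ≡ᵇ 0) ≡
           (if e ≡ᵇ suc i then outside else not (M (suc i) ≡ᵇ 0))
    head with e ≡ᵇ suc i
    ... | true  = ≡.refl
    ... | false = ≡.refl

  -- A common interface for both modes: sampling takes one step and touches only the sample bit.
  Samples : ∀ {m} → Carrier → Command m → Set _
  Samples {m} q sample = ∀ {i} (f : SetFunction i) C M →
    Mixture q (config C (setInts M scalarArray 1 1)) (config C (setInts M scalarArray 1 0))
      (Execution.execute f (config (sample ∷ C) M))

  -- Six commands of `observe`, the threshold branch, and at most seven more steps: recording the
  -- pass, sampling, a branch and the four commands of `accept`.
  budget : ℕ → ℕ
  budget i = 14 ℕ.* i ℕ.^ 0

  module Behaviour {m} (a b : ℕ) (sample : Command m) {q} (samples : Samples q sample) where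

    algorithm : OnlineAlgorithm
    algorithm = implementedBy (keepLatest a b sample) budget

    open OnlineAlgorithm algorithm public

    array : ℕ → Config m → ℕ → ℕ
    array x χ = Memory.ints (Config.store χ) x

    record Represents (k : ℕ) {i} (f : SetFunction i) (A D : Subset i) (χ : Config m) :
                      Set (c ⊔ ℓ₁ ⊔ ℓ₂) where
      field
        halted    : Config.code χ ≡ []
        capacity≡ : Memory.k (Config.store χ) ≡ k
        history≡  : selected (array historyArray χ) i ≡ A
        passed≡   : selected (array passedArray χ) i ≡ D
        solution≡ : selected (array solutionArray χ) i ≡ latest k A
        size≡     : array scalarArray χ 0 ≡ ∣ A ∣
        -- This includes j at least the size of `A`: the truncated difference is then 0, and entry 0
        -- of the queue is 0, as is `time j A`.
        queue≡    : ∀ j → array queueArray χ (∣ A ∣ ∸ j) ≡ time j A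
        history⊆  : A ⊆ D
        growing   : Growing (fromℕ a) (fromℕ b * fromℕ k) f A

    -- After a pass `D` grows in both outcomes, since it records the test; the coin decides only
    -- about `A`.
    data Arrival (k : ℕ) {i} (f : SetFunction (suc i)) (A D : Subset i) :
                 Random (Config m) → Set (c ⊔ ℓ₁ ⊔ ℓ₂) where
      fails  : ∀ {χ} → ¬ Passes (fromℕ a) (fromℕ b * fromℕ k) f A →
               Represents k f (outside ∷ A) (outside ∷ D) χ → Arrival k f A D (return χ)
      passes : ∀ {χ₁ χ₀ ξ} → Passes (fromℕ a) (fromℕ b * fromℕ k) f A →
               Represents k f (inside ∷ A) (inside ∷ D) χ₁ →
               Represents k f (outside ∷ A) (inside ∷ D) χ₀ →
               Mixture q χ₁ χ₀ ξ → Arrival k f A D ξ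

    arrival : ∀ k {i} (f : SetFunction (suc i)) {A D} (χ : Config m) →
              Represents k (restrict f) A D χ → Arrival k f A D (step f χ)
    arrival k {i} f {A} {D} χ rep = cases (fromℕ a * x ≤? fromℕ b * fromℕ (Memory.k M) * (y - x))
      where
      open Represents rep
      M = Config.store χ
      S = array solutionArray χ
      H = array historyArray χ
      P = array passedArray χ
      T = array scalarArray χ 0
      x = f (selected (put H (suc i) 0) (suc i))
      y = f (selected (put (put H (suc i) 0) (suc i) 1) (suc i))

      x≡ : x ≡ f (outside ∷ A)
      x≡ = ≡.cong f (≡.trans (selected-put-top H i 0) (≡.cong (outside ∷_) history≡))

      y≡ : y ≡ f (inside ∷ A)
      y≡ = ≡.cong f (≡.trans (selected-put-put H i 0 1) (≡.cong (inside ∷_) history≡))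

      open Execution f

      observed : Memory
      observed = setNums (setInts (setNums (setInts (setInts (setInts M
        solutionArray (suc i) 0) passedArray (suc i) 0) historyArray (suc i) 0) 0 0 x)
        historyArray (suc i) 1) 0 1 y

      -- The first seven steps evaluate by computation alone. Abstracting the outcome of the test
      -- from the remaining seven makes a case distinction on the comparison possible.
      resume : Bool → Random (Config m)
      resume t = executeFor 7 (config ((if t
        then (setInt passedArray revealed (lit 1) ∷ sample ∷
              branch (lit 1 ≤ⁱ sampleBit) accept reject ∷ [])
        else reject) ++ []) observed)

      PassesTest : Set ℓ₂
      PassesTest = fromℕ a * x ≤ fromℕ b * fromℕ (Memory.k M) * (y - x)

      PassesTest≡Passes : PassesTest ≡ Passes (fromℕ a) (fromℕ b * fromℕ k) f A
      PassesTest≡Passes = ≡.trans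
        (≡.cong₂ (λ u v → fromℕ a * u ≤ fromℕ b * fromℕ (Memory.k M) * (v - u)) x≡ y≡)
        (≡.cong (λ h → Passes (fromℕ a) (fromℕ b * fromℕ h) f A) capacity≡)

      H₁ = put (put H (suc i) 0) (suc i) 1
      S₁ = put (put S (suc i) 0) (suc i) 1

      Q₁ = put (array queueArray χ) (T ℕ.+ 1) (suc i)

      T+1≡ : T ℕ.+ 1 ≡ suc ∣ A ∣
      T+1≡ = ≡.trans (ℕₚ.+-comm T 1) (≡.cong suc size≡)

      Q₁≡ : ∀ j → Q₁ (suc ∣ A ∣ ∸ j) ≡ time j (inside ∷ A)
      Q₁≡ zero    rewrite T+1≡ | ≡ᵇ-refl ∣ A ∣ = ≡.refl
      -- The new entry has index `suc ∣ A ∣`, and `∣ A ∣ ∸ j` lies below it, so the older entries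
      -- are intact.
      Q₁≡ (suc j) rewrite T+1≡ | >⇒≡ᵇ-false (ℕ.s≤s (ℕₚ.m∸n≤m ∣ A ∣ j)) = queue≡ j

      -- For its second query `observe` puts the new element into the history; `reject` takes it out
      -- again.
      out≡ : selected (put H₁ (suc i) 0) (suc i) ≡ outside ∷ A
      out≡ = ≡.trans (selected-put-top H₁ i 0) (≡.cong (outside ∷_)
        (≡.trans (selected-put-> (put H (suc i) 0) 1 (ℕₚ.n<1+n i))
          (≡.trans (selected-put-> H 0 (ℕₚ.n<1+n i)) history≡)))

      e = T ℕ.+ 1 ∸ Memory.k M

      S₁≡ : selected (put S₁ (Q₁ e) 0) (suc i) ≡ latest k (inside ∷ A)
      S₁≡ = begin
        selected (put S₁ (Q₁ e) 0) (suc i)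
          ≡⟨ selected-put-0 S₁ (Q₁ e) (suc i) ⟩
        remove (Q₁ e) (selected S₁ (suc i))
          ≡⟨ ≡.cong₂ remove (≡.trans (≡.cong Q₁ (≡.cong₂ _∸_ T+1≡ capacity≡)) (Q₁≡ k))
               (≡.trans (selected-put-put S i 0 1) (≡.cong (inside ∷_) solution≡)) ⟩
        remove (time k (inside ∷ A)) (inside ∷ latest k A)
          ≡⟨ latest-inside k A ⟩
        latest k (inside ∷ A) ∎
        where open ≡.≡-Reasoning

      cases : (d : Dec PassesTest) → Arrival k f A D (resume (does d))
      cases (no ¬test)  = fails (λ p → ¬test (≡.subst id (≡.sym PassesTest≡Passes) p)) record
        { halted    = ≡.refl
        ; capacity≡ = capacity≡
        ; history≡  = out≡
        ; passed≡   = ≡.trans (selected-put-top P i 0) (≡.cong (outside ∷_) passed≡)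
        ; solution≡ = ≡.trans (selected-put-top S i 0) (≡.cong (outside ∷_) solution≡)
        ; size≡     = size≡
        ; queue≡    = queue≡
        ; history⊆  = Subsetₚ.out⊆ history⊆
        ; growing   = growing
        }
      cases (yes test) = passes (≡.subst id PassesTest≡Passes test)
        record
        { halted    = ≡.refl
        ; capacity≡ = capacity≡
        ; history≡  = ≡.trans (selected-put-put H i 0 1) (≡.cong (inside ∷_) history≡)
        ; passed≡   = ≡.trans (selected-put-put P i 0 1) (≡.cong (inside ∷_) passed≡)
        ; solution≡ = S₁≡
        ; size≡     = T+1≡
        ; queue≡    = Q₁≡
        ; history⊆  = Subsetₚ.in⊆in history⊆
        ; growing   = growing , ≡.subst id PassesTest≡Passes test
        }
        record
        { halted    = ≡.refl
        ; capacity≡ = capacity≡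
        ; history≡  = out≡
        ; passed≡   = ≡.trans (selected-put-put P i 0 1) (≡.cong (inside ∷_) passed≡)
        ; solution≡ = ≡.trans (selected-put-top S i 0) (≡.cong (outside ∷_) solution≡)
        ; size≡     = size≡
        ; queue≡    = queue≡
        ; history⊆  = Subsetₚ.out⊆ history⊆
        ; growing   = growing
        }
        (Mixture->>= (samples f _ _) ≡.refl ≡.refl)

-- Analysis of the competitive ratio for general a, b and q.

module Analysis {c ℓ₁ ℓ₂} (ℝ : ArchimedeanOrderedField c ℓ₁ ℓ₂)
  {m} (a b : ℕ) .{{b≢0 : ℕ.NonZero b}} (sample : Command m) {q}
  (samples : Implementation.Samples ℝ q sample)
  (0≤q : ArchimedeanOrderedField._≤_ ℝ (ArchimedeanOrderedField.0# ℝ) q)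
  (q≤1 : ArchimedeanOrderedField._≤_ ℝ q (ArchimedeanOrderedField.1# ℝ)) where

  open ArchimedeanOrderedField ℝ
  open OrderedFieldProperties ℝ
  open Model ℝ
  open Probability ℝ
  open Submodularity ℝ
  open Implementation ℝ
  open Behaviour a b sample samples
  open Solver using (solve; _:=_; _:+_; _:*_; _:-_; con)

  α β : Carrier
  α = fromℕ a
  β = fromℕ b

  0≤α : 0# ≤ α
  0≤α = fromℕ-nonNeg a

  0<β : 0# < β
  0<β = fromℕ-pos b

  Reached : ∀ {i} → ℕ → SetFunction i → Config m → Set (c ⊔ ℓ₁ ⊔ ℓ₂)
  Reached k f χ = ∃₂ λ A D → Represents k f A D χ

  arrival-surely : ∀ {k i} {f : SetFunction (suc i)} {A D ξ p} {Q : Config m → Set p} →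
    Arrival k f A D ξ → (∀ t s χ → Represents k f (t ∷ A) (s ∷ D) χ → Q χ) → Surely Q ξ
  arrival-surely (fails _ rep)            Q = Q _ _ _ rep
  arrival-surely (passes _ rep₁ rep₀ mix) Q = Mixture.surely mix (Q _ _ _ rep₁) (Q _ _ _ rep₀)

  run-reached : ∀ {n} k (f : SetFunction n) → Surely (Reached k f) (run k f)
  run-reached {zero}  k f = [] , [] , record
    { halted = ≡.refl ; capacity≡ = ≡.refl ; history≡ = ≡.refl ; passed≡ = ≡.refl
    ; solution≡ = ≡.refl ; size≡ = ≡.refl ; queue≡ = λ _ → ≡.refl
    ; history⊆ = Subsetₚ.⊆-refl ; growing = tt }
  run-reached {suc n} k f = Surely->>= (run k (restrict f))
    (Surely-map (λ { χ (A , D , rep) → arrival-surely (arrival k f χ rep) (λ t s _ rep′ → t ∷ A , s ∷ D , rep′) })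
      (run k (restrict f)) (run-reached k (restrict f)))

  at-each-arrival : ∀ {p} {Q : ∀ {i} → State i → State (suc i) → Set p} k →
    (∀ {i} (f : SetFunction (suc i)) {A D t s χ χ′} → Represents k (restrict f) A D χ →
      Represents k f (t ∷ A) (s ∷ D) χ′ → Q {i} χ χ′) →
    ∀ {n} (f : SetFunction n) → AtEachArrival (λ {i} → Q {i}) k f
  at-each-arrival k holds {zero}  f = tt
  at-each-arrival {Q = Q} k holds {suc n} f = at-each-arrival {Q = Q} k holds (restrict f) ,
    Surely-map (λ { χ (_ , _ , rep) → arrival-surely (arrival k f χ rep) (λ _ _ _ → holds f rep) })
      (run k (restrict f)) (run-reached k (restrict f))

  halts : ∀ (𝓕 : Objectives) → HaltsWithin budget (keepLatest a b sample) 𝓕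
  halts 𝓕 n k f _ _ = at-each-arrival {Q = λ _ χ → Config.code χ ≡ []} k (λ _ _ rep → Represents.halted rep) f

  feasible : ∀ {n} k (f : SetFunction n) → MaintainsFeasibility k f
  feasible k f = at-each-arrival
    {Q = λ {i} χ χ′ → solution {suc i} χ′ ⊆ inside ∷ solution {i} χ × Feasible k (solution {suc i} χ′)}
    k exchange f
    where
    exchange : ∀ {i} (f : SetFunction (suc i)) {A D t s χ χ′} → Represents k (restrict f) A D χ →
      Represents k f (t ∷ A) (s ∷ D) χ′ →
      solution {suc i} χ′ ⊆ inside ∷ solution {i} χ × Feasible k (solution {suc i} χ′)
    exchange f {A} {t = t} rep rep′ =
      ≡.subst₂ (λ S S′ → S′ ⊆ inside ∷ S × Feasible k S′)
        (≡.sym (Represents.solution≡ rep)) (≡.sym (Represents.solution≡ rep′))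
        (latest-∷-⊆ k t A , ∣latest∣≤ k (t ∷ A))

  value : ∀ {i} → (Subset i → Subset i → Carrier) → Config m → Carrier
  value {i} G χ = G (selected (array historyArray χ) i) (selected (array passedArray χ) i)

  value≡ : ∀ {k i} {f : SetFunction i} {A D χ} (G : Subset i → Subset i → Carrier) →
           Represents k f A D χ → value G χ ≡ G A D
  value≡ G rep = ≡.cong₂ G (Represents.history≡ rep) (Represents.passed≡ rep)

  -- By total expectation over the last arrival, it suffices to compare the potentials `G` and `G′`
  -- at each pair `A ⊆ D`, separately for a failed and a passed test.
  submartingale : ∀ {n} k (f : SetFunction (suc n))
    (G : Subset n → Subset n → Carrier) (G′ : Subset (suc n) → Subset (suc n) → Carrier) →
    (∀ {A D} → A ⊆ D → ¬ Passes α (β * fromℕ k) f A → G A D ≤ G′ (outside ∷ A) (outside ∷ D)) →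
    (∀ {A D} → A ⊆ D → Passes α (β * fromℕ k) f A →
      G A D ≤ q * G′ (inside ∷ A) (inside ∷ D) + (1# - q) * G′ (outside ∷ A) (inside ∷ D)) →
    𝔼 (value G) (run k (restrict f)) ≤ 𝔼 (value G′) (run k f)
  submartingale k f G G′ onFail onPass = ≤-trans
    (𝔼-mono (run k (restrict f)) (Surely-map one-step (run k (restrict f)) (run-reached k (restrict f))))
    (≤-reflexive (sym (reflexive (𝔼->>= (value G′) (run k (restrict f)) (step f)))))
    where
    after : ∀ {A D χ ξ} → Represents k (restrict f) A D χ → Arrival k f A D ξ → G A D ≤ 𝔼 (value G′) ξ
    after rep (fails ¬pass rep₀) = ≤-trans (onFail (Represents.history⊆ rep) ¬pass)
      (≤-reflexive (sym (reflexive (value≡ G′ rep₀))))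
    after rep (passes pass rep₁ rep₀ mix) = ≤-trans (onPass (Represents.history⊆ rep) pass)
      (≤-reflexive (sym (trans (Mixture.expectation mix (value G′))
        (+-cong (*-congˡ (reflexive (value≡ G′ rep₁))) (*-congˡ (reflexive (value≡ G′ rep₀)))))))

    one-step : ∀ χ → Reached k (restrict f) χ → value G χ ≤ 𝔼 (value G′) (step f χ)
    one-step χ (A , D , rep) = ≤-trans (≤-reflexive (reflexive (value≡ G rep))) (after rep (arrival k f χ rep))

  -- Coupling with the set D of all elements that pass the test: an element that
  -- passes joins A only with probability q, and its marginal value with respect
  -- to A ⊆ D is the larger one.
  sampling-loss : ∀ {n} k (f g : SetFunction n) → Submodular g →
    (1# - q) * g ⊥ ≤ 𝔼 (value (λ A D → g A - q * g D)) (run k f)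
  sampling-loss {zero} k f g sub = ≤-reflexive
    (solve 2 (λ q x → (con (+ 1) :- q) :* x := x :- q :* x) refl q (g []))
  sampling-loss {suc n} k f g sub = ≤-trans
    (sampling-loss k (restrict f) (restrict g) (restrict-submodular sub))
    (submartingale k f (λ A D → restrict g A - q * restrict g D) (λ A D → g A - q * g D)
      (λ _ _ → ≤-refl) (λ {A} {D} A⊆D _ →
      -- The slack is q times the marginal value at `A` minus that at `D`.
      ≤-by (*-nonNeg 0≤q (0≤y-x (marginal-decreasing sub A⊆D)))
        (solve 5 (λ q x y x′ y′ →
          q :* (y :- q :* y′) :+ (con (+ 1) :- q) :* (x :- q :* y′) :=
          (x :- q :* x′) :+ q :* ((y :+ x′) :- (y′ :+ x)))
          refl q (g (outside ∷ A)) (g (inside ∷ A)) (g (outside ∷ D)) (g (inside ∷ D)))))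

  -- Pays for f (O ∪ A) - f A: an element of O that fails the test costs at most
  -- α * f A / κ, and one that passes has, in expectation over its sampling, its
  -- whole marginal value paid for by the increase of f A / q.
  surplus : ∀ {n} → ℕ → SetFunction n → Subset n → Subset n → Carrier
  surplus k f O A =
    (β * fromℕ k) * f A + q * (fromℕ ∣ O ∣ * α) * f A - q * (β * fromℕ k) * f (O ∪ A)

  -- The surplus starts at (1 - q) κ times the value of the empty set, and no arrival lowers its
  -- expectation, whatever the test says and whether or not the element is in `O`.
  surplus-nonNeg : ∀ {n} k .{{_ : ℕ.NonZero k}} (f : SetFunction n) → NonNegative f → Submodular f →
    ∀ O → 0# ≤ 𝔼 (value (λ A _ → surplus k f O A)) (run k f)
  surplus-nonNeg {zero} k f 0≤f sub [] =
    ≤-by (*-nonNeg (*-nonNeg (0≤y-x q≤1) (proj₁ (*-pos 0<β (fromℕ-pos k)))) (0≤f []))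
      (solve 4 (λ q κ α x → κ :* x :+ q :* (con (+ 0) :* α) :* x :- q :* κ :* x :=
        con (+ 0) :+ (con (+ 1) :- q) :* κ :* x) refl q (β * fromℕ k) α (f []))
  surplus-nonNeg {suc n} k f 0≤f sub (o ∷ O) = ≤-trans
    (surplus-nonNeg k (restrict f) (0≤f ∘ (outside ∷_)) (restrict-submodular sub) O)
    (submartingale k f (λ A _ → surplus k (restrict f) O A) (λ A _ → surplus k f (o ∷ O) A)
      (λ _ → onFail o) (λ _ → onPass o))
    where
    κ = β * fromℕ k
    0<κ = *-pos 0<β (fromℕ-pos k)
    0≤κ = proj₁ 0<κ
    μ = fromℕ ∣ O ∣
    0≤μ = fromℕ-nonNeg ∣ O ∣

    diminishing : ∀ A → 0# ≤ (f (inside ∷ A) + f (outside ∷ (O ∪ A))) -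
                             (f (inside ∷ (O ∪ A)) + f (outside ∷ A))
    diminishing A = 0≤y-x (marginal-decreasing sub (Subsetₚ.q⊆p∪q O A))

    onFail : ∀ o {A} → ¬ Passes α κ f A →
      surplus k (restrict f) O A ≤ surplus k f (o ∷ O) (outside ∷ A)
    onFail outside     _     = ≤-refl
    -- The new element of `O` contributes q α f A. By the failed test and diminishing returns this
    -- covers q κ times its marginal value over `O ∪ A`.
    onFail inside  {A} ¬pass with total (α * f (outside ∷ A)) (κ * (f (inside ∷ A) - f (outside ∷ A)))
    ... | inj₁ pass = contradiction pass ¬pass
    ... | inj₂ fail = ≤-by
      (+-nonNeg (*-nonNeg 0≤q (0≤y-x fail)) (*-nonNeg (*-nonNeg 0≤q 0≤κ) (diminishing A)))
      (solve 8 (λ q κ α μ x y X Y →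
        κ :* x :+ q :* ((con (+ 1) :+ μ) :* α) :* x :- q :* κ :* Y :=
        (κ :* x :+ q :* (μ :* α) :* x :- q :* κ :* X) :+
        (q :* (α :* x :- κ :* (y :- x)) :+ (q :* κ) :* ((y :+ X) :- (Y :+ x))))
        refl q κ α μ (f (outside ∷ A)) (f (inside ∷ A))
        (f (outside ∷ (O ∪ A))) (f (inside ∷ (O ∪ A))))

    onPass : ∀ o {A} → Passes α κ f A →
      surplus k (restrict f) O A ≤
      q * surplus k f (o ∷ O) (inside ∷ A) + (1# - q) * surplus k f (o ∷ O) (outside ∷ A)
    onPass o {A} pass = bound o
      where
      x = f (outside ∷ A)
      y = f (inside ∷ A)
      X = f (outside ∷ (O ∪ A))
      Y = f (inside ∷ (O ∪ A))

      0≤gain : 0# ≤ y - x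
      0≤gain = *-cancelˡ-≤ 0<κ (≤-trans (≤-reflexive (zeroʳ κ))
        (≤-trans (*-nonNeg 0≤α (0≤f (outside ∷ A))) pass))

      bound : ∀ o → surplus k (restrict f) O A ≤
        q * surplus k f (o ∷ O) (inside ∷ A) + (1# - q) * surplus k f (o ∷ O) (outside ∷ A)
      -- Acceptance costs q κ times the marginal value over `O ∪ A`, but gains at least κ times the
      -- one over `A`, which is nonnegative and no smaller; and q ≤ 1.
      bound outside = ≤-by
        (+-nonNeg (*-nonNeg (+-nonNeg (*-nonNeg (*-nonNeg 0≤q (0≤y-x q≤1)) 0≤κ)
                              (*-nonNeg (*-nonNeg 0≤q 0≤q) (*-nonNeg 0≤μ 0≤α))) 0≤gain)
          (*-nonNeg (*-nonNeg (*-nonNeg 0≤q 0≤q) 0≤κ) (diminishing A)))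
        (solve 8 (λ q κ α μ x y X Y →
          q :* (κ :* y :+ q :* (μ :* α) :* y :- q :* κ :* Y) :+
          (con (+ 1) :- q) :* (κ :* x :+ q :* (μ :* α) :* x :- q :* κ :* X) :=
          (κ :* x :+ q :* (μ :* α) :* x :- q :* κ :* X) :+
          ((q :* (con (+ 1) :- q) :* κ :+ q :* q :* (μ :* α)) :* (y :- x) :+
           q :* q :* κ :* ((y :+ X) :- (Y :+ x))))
          refl q κ α μ x y X Y)
      -- The new element is in `O`, so the union has value `Y` whatever the coin shows. The certain
      -- loss q κ (Y - X) is paid by the expected gain q κ (y - x).
      bound inside = ≤-by
        (+-nonNeg (*-nonNeg (*-nonNeg 0≤q 0≤κ) (diminishing A))
          (*-nonNeg (*-nonNeg 0≤q 0≤α)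
            (+-nonNeg (0≤f (outside ∷ A))
              (*-nonNeg (*-nonNeg 0≤q (+-nonNeg 0≤1 0≤μ)) 0≤gain))))
        (solve 8 (λ q κ α μ x y X Y →
          q :* (κ :* y :+ q :* ((con (+ 1) :+ μ) :* α) :* y :- q :* κ :* Y) :+
          (con (+ 1) :- q) :* (κ :* x :+ q :* ((con (+ 1) :+ μ) :* α) :* x :- q :* κ :* Y) :=
          (κ :* x :+ q :* (μ :* α) :* x :- q :* κ :* X) :+
          (q :* κ :* ((y :+ X) :- (Y :+ x)) :+
           q :* α :* (x :+ q :* (con (+ 1) :+ μ) :* (y :- x))))
          refl q κ α μ x y X Y)

  -- Here r is the fraction of f O that the expected value of f (O ∪ A) retains. With c = α / β, the
  -- premise of `ratio` expresses the ratio c q r / ((1 + c) (1 + c q)), with β² cleared.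
  competitive : ∀ (𝓕 : Objectives) {r} u v .{{_ : ℕ.NonZero v}} → u ℕ.≤ v →
    (∀ {n} {f : SetFunction n} → 𝓕 f → NonNegative f) →
    (∀ {n} {f : SetFunction n} → 𝓕 f → Submodular f) →
    (∀ {n} k (f : SetFunction n) → 𝓕 f → ∀ O → r * f O ≤ 𝔼 (value (λ A _ → f (O ∪ A))) (run k f)) →
    (∀ {x y} → 0# ≤ x → α * β * q * r * x ≤ (α + β) * (β + q * α) * y → (fromℕ u ÷ fromℕ v) * x ≤ y) →
    Competitive algorithm 𝓕 (fromℕ u ÷ fromℕ v)
  competitive 𝓕 {r} u v u≤v nonNeg submod retains ratio n k f _ f∈𝓕 =
    feasible k f , λ O → bound k O ∘ proj₁
    where
    0≤f = nonNeg f∈𝓕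

    reward : Config m → Carrier
    reward = f ∘ solution {n}

    bound : ∀ k O → ∣ O ∣ ℕ.≤ k → (fromℕ u ÷ fromℕ v) * f O ≤ 𝔼 reward (run k f)
    -- With capacity 0 both `O` and the solution are empty, so u ≤ v is enough.
    bound zero O ∣O∣≤0 = fraction-≤ u v 1 1
      (ℕₚ.*-monoˡ-≤ 1 u≤v) (0≤f O) (*-monoˡ-≤ (fromℕ-nonNeg 1) (≤-trans
        (≤-reflexive (sym (𝔼-const (f O) (run 0 f))))
        (𝔼-mono (run 0 f) (Surely-map (λ { χ (A , _ , rep) → ≤-reflexive (reflexive (≡.cong f (same rep))) })
          (run 0 f) (run-reached 0 f)))))
      where
      same : ∀ {A D χ} → Represents 0 f A D χ → O ≡ solution χ
      same {A} rep = ≡.trans (∣p∣≤0⇒p≡⊥ O ∣O∣≤0)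
        (≡.sym (≡.trans (Represents.solution≡ rep) (∣p∣≤0⇒p≡⊥ _ (∣latest∣≤ 0 A))))
    bound k@(suc k-1) O ∣O∣≤k = ratio (0≤f O) (*-cancelˡ-≤ (fromℕ-pos k) (≤-trans lower
      (≤-trans (≤-trans (≤-reflexive (sym (𝔼-linear _ _ _ _ ξ))) (𝔼-mono ξ
        (Surely-map (λ { χ (_ , _ , rep) → pointwise rep }) ξ (run-reached k f)))) upper)))
      where
      ξ = run k f
      κ = β * fromℕ k
      K = fromℕ k * ((α + β) * (β + q * α))
      gain = value (λ A _ → surplus k f O A)
      union = value (λ A _ → f (O ∪ A))
      0≤αqκ = *-nonNeg (*-nonNeg 0≤α 0≤q) (proj₁ (*-pos 0<β (fromℕ-pos k)))

      -- Adding α q κ f (O ∪ A) to α times the surplus cancels the union term. The expectation of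
      -- this sum is bounded below here, and the sum itself is bounded above by `pointwise`.
      lower : fromℕ k * (α * β * q * r * f O) ≤ α * 𝔼 gain ξ + α * q * κ * 𝔼 union ξ
      lower = ≤-by (+-nonNeg
        (*-nonNeg 0≤α (surplus-nonNeg k f 0≤f (submod f∈𝓕) O))
        (*-nonNeg 0≤αqκ (0≤y-x (retains k f f∈𝓕 O))))
        (solve 8 (λ α β q r k x s y →
          α :* s :+ α :* q :* (β :* k) :* y :=
          k :* (α :* β :* q :* r :* x) :+ (α :* s :+ α :* q :* (β :* k) :* (y :- r :* x)))
          refl α β q r (fromℕ k) (f O) (𝔼 gain ξ) (𝔼 union ξ))

      -- The zero summand lets `𝔼-linear` extract the factor `K`.
      upper : 𝔼 (λ χ → K * reward χ + 0# * reward χ) ξ ≤ fromℕ k * ((α + β) * (β + q * α) * 𝔼 reward ξ)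
      upper = ≤-reflexive (trans (𝔼-linear K 0# reward reward ξ)
        (solve 5 (λ α β q k e →
          k :* ((α :+ β) :* (β :+ q :* α)) :* e :+ con (+ 0) :* e := k :* ((α :+ β) :* (β :+ q :* α) :* e))
          refl α β q (fromℕ k) (𝔼 reward ξ)))

      -- Two losses occur: `latest-bound` passes from f A to the solution, and `∣ O ∣` is replaced
      -- by k.
      pointwise : ∀ {A D χ} → Represents k f A D χ →
        α * gain χ + α * q * κ * union χ ≤ K * reward χ + 0# * reward χ
      pointwise {A} {χ = χ} rep = ≤-resp-≈
        (+-cong (*-congˡ (reflexive (≡.sym (value≡ (λ A _ → surplus k f O A) rep))))
                (*-congˡ (reflexive (≡.sym (value≡ (λ A _ → f (O ∪ A)) rep)))))
        (reflexive (≡.cong (λ S → K * f S + 0# * f S) (≡.sym (Represents.solution≡ rep))))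
        (≤-by (+-nonNeg
          (*-nonNeg (*-nonNeg (fromℕ-nonNeg k) (+-nonNeg (proj₁ 0<β) (*-nonNeg 0≤q 0≤α)))
            (0≤y-x (latest-bound 0≤α 0<β f 0≤f (submod f∈𝓕) A (Represents.growing rep))))
          (*-nonNeg (*-nonNeg (*-nonNeg 0≤α 0≤q) (*-nonNeg 0≤α (0≤f A))) (0≤y-x (fromℕ-mono ∣O∣≤k))))
          (solve 8 (λ α β q k μ x s X →
            k :* ((α :+ β) :* (β :+ q :* α)) :* s :+ con (+ 0) :* s :=
            (α :* ((β :* k) :* x :+ q :* (μ :* α) :* x :- q :* (β :* k) :* X) :+ α :* q :* (β :* k) :* X) :+
            (k :* (β :+ q :* α) :* ((α :+ β) :* s :- α :* x) :+ α :* q :* (α :* x) :* (k :- μ)))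
            refl α β q (fromℕ k) (fromℕ ∣ O ∣) (f A) (f (latest k A)) (f (O ∪ A))))

-- The two choices of parameters.

module Instances {c ℓ₁ ℓ₂} (ℝ : ArchimedeanOrderedField c ℓ₁ ℓ₂) where

  open ArchimedeanOrderedField ℝ
  open OrderedFieldProperties ℝ
  open Model ℝ
  open Probability ℝ
  open Submodularity ℝ
  open Implementation ℝ
  open Solver using (solve; _:=_; _:+_; _:*_; _:-_; con)

  private module ≈ = Relation.Binary.Reasoning.Setoid setoid

  acceptAlways : Command deterministic
  acceptAlways = setInt scalarArray (lit 1) (lit 1)

  acceptAlways-samples : Samples 1# acceptAlways
  acceptAlways-samples f C M = return-mixture _ _

  -- Monotonicity gives r = 1, and with α = β = q = 1 the general inequality becomes x ≤ 4 y.
  1/4-competitive : Competitive (implementedBy (keepLatest 1 1 acceptAlways) budget)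
                      monotoneSubmodular (fromℕ 1 ÷ fromℕ 4)
  1/4-competitive = competitive monotoneSubmodular 1 4 (ℕ.s≤s ℕ.z≤n) proj₁ (proj₁ ∘ proj₂)
    (λ {n} k f f∈𝓕 O → ≤-trans (≤-reflexive (trans (*-identityˡ (f O)) (sym (𝔼-const (f O) (run k f)))))
      (𝔼-mono (run k f) (Surely-map (λ χ _ → proj₂ (proj₂ f∈𝓕) (Subsetₚ.p⊆p∪q _)) (run k f) (run-reached k f))))
    (λ {x} {y} 0≤x h → fraction-≤ 1 4 1 4 ℕₚ.≤-refl 0≤x (≤-resp-≈
      (trans (*-congʳ (*-congʳ (*-congʳ (*-cong 1≈ 1≈))))
        (trans (solve 1 (λ x → con (+ 1) :* con (+ 1) :* con (+ 1) :* con (+ 1) :* x := con (+ 1) :* x) refl x)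
          (*-congʳ (sym 1≈))))
      (trans (*-congʳ (*-cong (+-cong 1≈ 1≈) (+-cong 1≈ (*-congˡ 1≈))))
        (solve 1 (λ y → (con (+ 1) :+ con (+ 1)) :* (con (+ 1) :+ con (+ 1) :* con (+ 1)) :* y := con (+ 4) :* y) refl y))
      h))
    where
    open Analysis ℝ 1 1 acceptAlways acceptAlways-samples 0≤1 ≤-refl
    open Behaviour 1 1 acceptAlways acceptAlways-samples
    1≈ : fromℕ 1 ≈ 1#
    1≈ = +-identityʳ 1#

  ⅖ : Carrier
  ⅖ = fromℕ 2 ÷ fromℕ 5

  5*⅖≈2 : fromℕ 5 * ⅖ ≈ fromℕ 2
  5*⅖≈2 = *-÷-cancel (fromℕ 2) (fromℕ-pos 5)

  0≤⅖ : 0# ≤ ⅖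
  0≤⅖ = *-cancelˡ-≤ (fromℕ-pos 5) (≤-resp-≈ (sym (zeroʳ (fromℕ 5))) (sym 5*⅖≈2) (fromℕ-nonNeg 2))

  ⅖≤1 : ⅖ ≤ 1#
  ⅖≤1 = *-cancelˡ-≤ (fromℕ-pos 5) (≤-resp-≈ (sym 5*⅖≈2) (sym (*-identityʳ (fromℕ 5)))
    (fromℕ-mono {2} {5} (ℕₚ.≤ᵇ⇒≤ 2 5 _)))

  acceptTwoFifths : Command randomized
  acceptTwoFifths = toss scalarArray (lit 1) (fromInt (lit 2) ⊘ fromInt (lit 5))

  acceptTwoFifths-samples : Samples ⅖ acceptTwoFifths
  acceptTwoFifths-samples f C M = tossCoin-mixture 0≤⅖ ⅖≤1 _ _

  56/627-competitive : Competitive (implementedBy (keepLatest 3 2 acceptTwoFifths) budget)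
                         nonNegativeSubmodular (fromℕ 56 ÷ fromℕ 627)
  56/627-competitive = competitive nonNegativeSubmodular 56 627 (ℕₚ.≤ᵇ⇒≤ 56 627 _) proj₁ proj₂
    retains
    -- Multiplication by 25 clears the denominators of q and 1 - q and leaves 36 x ≤ 400 y. The
    -- numerals compare 56 * 400 with 627 * 36.
    (λ {x} {y} 0≤x h → fraction-≤ 56 627 36 400 (ℕₚ.≤ᵇ⇒≤ 22400 22572 _) 0≤x
      (≤-resp-≈ (lhs x) (rhs y) (*-monoˡ-≤ (fromℕ-nonNeg 25) h)))
    where
    open Analysis ℝ 3 2 acceptTwoFifths acceptTwoFifths-samples 0≤⅖ ⅖≤1
    open Behaviour 3 2 acceptTwoFifths acceptTwoFifths-samples

    retains : ∀ {n} k (f : SetFunction n) → nonNegativeSubmodular f → ∀ O →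
              (1# - ⅖) * f O ≤ 𝔼 (value (λ A _ → f (O ∪ A))) (run k f)
    -- The coupling bound is applied to g A = f (O ∪ A), whose value at the empty set is f O; the
    -- subtracted term q g D is nonnegative and is dropped.
    retains k f (0≤f , sub) O = ≤-trans
      (≤-reflexive (*-congˡ (reflexive (≡.cong f (≡.sym (Subsetₚ.∪-identityʳ O))))))
      (≤-trans (sampling-loss k f (λ A → f (O ∪ A)) (union-submodular O sub))
        (𝔼-mono (run k f) (Surely-map (λ χ _ → ≤-by (*-nonNeg 0≤⅖ (0≤f _))
          (solve 2 (λ u v → u := (u :- v) :+ v) refl _ _)) (run k f) (run-reached k f))))

    lhs : ∀ x → fromℕ 25 * (fromℕ 3 * fromℕ 2 * ⅖ * (1# - ⅖) * x) ≈ fromℕ 36 * x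
    lhs x = begin
      fromℕ 25 * (fromℕ 3 * fromℕ 2 * ⅖ * (1# - ⅖) * x)
        ≈⟨ solve 2 (λ q x →
             con (+ 25) :* (con (+ 3) :* con (+ 2) :* q :* (con (+ 1) :- q) :* x) :=
             con (+ 6) :* (con (+ 5) :* q) :* (con (+ 5) :- con (+ 5) :* q) :* x) refl ⅖ x ⟩
      fromℕ 6 * (fromℕ 5 * ⅖) * (fromℕ 5 - fromℕ 5 * ⅖) * x
        ≈⟨ *-congʳ (*-cong (*-congˡ 5*⅖≈2) (+-congˡ (-‿cong 5*⅖≈2))) ⟩
      fromℕ 6 * fromℕ 2 * (fromℕ 5 - fromℕ 2) * x
        ≈⟨ solve 1 (λ x → con (+ 6) :* con (+ 2) :* (con (+ 5) :- con (+ 2)) :* x := con (+ 36) :* x) refl x ⟩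
      fromℕ 36 * x ∎
      where open ≈

    rhs : ∀ y → fromℕ 25 * ((fromℕ 3 + fromℕ 2) * (fromℕ 2 + ⅖ * fromℕ 3) * y) ≈ fromℕ 400 * y
    rhs y = begin
      fromℕ 25 * ((fromℕ 3 + fromℕ 2) * (fromℕ 2 + ⅖ * fromℕ 3) * y)
        ≈⟨ solve 2 (λ q y →
             con (+ 25) :* ((con (+ 3) :+ con (+ 2)) :* (con (+ 2) :+ q :* con (+ 3)) :* y) :=
             (con (+ 250) :+ con (+ 75) :* (con (+ 5) :* q)) :* y) refl ⅖ y ⟩
      (fromℕ 250 + fromℕ 75 * (fromℕ 5 * ⅖)) * y
        ≈⟨ *-congʳ (+-congˡ (*-congˡ 5*⅖≈2)) ⟩
      (fromℕ 250 + fromℕ 75 * fromℕ 2) * y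
        ≈⟨ solve 1 (λ y → (con (+ 250) :+ con (+ 75) :* con (+ 2)) :* y := con (+ 400) :* y) refl y ⟩
      fromℕ 400 * y ∎
      where open ≈

  competitive-weaken : ∀ {A γ δ} → δ ≤ γ → Competitive A nonNegativeSubmodular γ →
                       Competitive A nonNegativeSubmodular δ
  competitive-weaken {γ = γ} {δ} δ≤γ comp n k f k≤n f∈𝓕 =
    proj₁ (comp n k f k≤n f∈𝓕) , λ O optimal →
      ≤-trans (≤-resp-≈ (*-comm (f O) δ) (*-comm (f O) γ) (*-monoˡ-≤ (proj₁ f∈𝓕 O) δ≤γ))
        (proj₂ (comp n k f k≤n f∈𝓕) O optimal)

theorem1p5 : ∀ {c ℓ₁ ℓ₂} (ℝ : ArchimedeanOrderedField c ℓ₁ ℓ₂) →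
    let open ArchimedeanOrderedField ℝ
        open Model ℝ
        56/627 = fromℕ 56 ÷ fromℕ 627
        1/4    = fromℕ 1 ÷ fromℕ 4
    in
    (Σ[ A ∈ OnlineAlgorithm ] Competitive A nonNegativeSubmodular 56/627)
    × (∀ ε → 0# < ε →
        Σ[ P ∈ Program randomized ]
          PolynomialTimeCompetitive P nonNegativeSubmodular (56/627 - ε))
    × (Σ[ P ∈ Program deterministic ]
        PolynomialTimeCompetitive P monotoneSubmodular 1/4)
theorem1p5 ℝ =
    (_ , 56/627-competitive)
  -- One program serves every ε, as it attains 56 / 627 itself; 14 and 0 are the coefficient and
  -- exponent of the budget.
  , (λ ε 0<ε → keepLatest 3 2 acceptTwoFifths , 14 , 0
      , Analysis.halts ℝ 3 2 acceptTwoFifths acceptTwoFifths-samples 0≤⅖ ⅖≤1 nonNegativeSubmodular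
      , competitive-weaken (x-ε≤x 0<ε) 56/627-competitive)
  , (keepLatest 1 1 acceptAlways , 14 , 0
      , Analysis.halts ℝ 1 1 acceptAlways acceptAlways-samples 0≤1 ≤-refl monotoneSubmodular
      , 1/4-competitive)
  where
  open ArchimedeanOrderedField ℝ
  open OrderedFieldProperties ℝ
  open Model ℝ
  open Instances ℝ

  x-ε≤x : ∀ {x ε} → 0# < ε → x - ε ≤ x
  x-ε≤x {x} {ε} (0≤ε , _) = ≤-by 0≤ε (solve 2 (λ x ε → x := (x :- ε) :+ ε) refl x ε)
    where open Solver
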